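{- For any odd prime $p$, any integer $\alpha\ge0$ and any integer $n\ge0$: (1) $b_{13}\!\left(4 p^{2\alpha+2}n+\frac{(8i+p)p^{2\alpha+1}-1}{2}\right)\equiv 0 \pmod 2$ for each $i=1,2,\ldots,p-1$; (2) $b_{13}\!\left(4 p^{2\alpha+1}n+\frac{(8j+1)p^{2\alpha}-1}{2}\right)\equiv 0 \pmod 2$ for every integer $j$ with $0\le j\le p-1$ and $\left(\frac{8j+1}{p}\right)=-1$.
   Context: For a positive integer $\ell$, $b_\ell(n)$ denotes the number of partitions of $n$ having no part divisible by $\ell$. $\left(\frac{a}{p}\right)$ is the Legendre symbol. -}

module Defs where

open import Data.Empty using (⊥-elim)
open import Data.Fin using (Fin; toℕ; fromℕ<)
open import Data.Fin.Properties using (any?; toℕ-fromℕ<)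
open import Data.Integer as ℤ using (ℤ; +_; 0ℤ; 1ℤ; -1ℤ)
import Data.Integer.Divisibility.Signed as ℤ∣
open import Data.Integer.DivMod using (_%ℕ_; _/ℕ_; n%ℕd<d; a≡a%ℕn+[a/ℕn]*n)
import Data.Integer.Tactic.RingSolver as ℤ-Solver
open import Data.List using (List; []; _∷_; _++_; map; filter; length)
open import Data.List.Membership.Propositional using (_∈_)
open import Data.List.Membership.Propositional.Properties
  using (∈-map⁺; ∈-map⁻; ∈-++⁺ˡ; ∈-++⁺ʳ; ∈-++⁻; ∈-filter⁺; ∈-filter⁻)
open import Data.List.Properties using (∷-injectiveʳ)
open import Data.List.Relation.Binary.Disjoint.Propositional using (Disjoint)
open import Data.List.Relation.Unary.All as All using (All; []; _∷_; all?)
open import Data.List.Relation.Unary.Any using (here)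
open import Data.List.Relation.Unary.Linked using (Linked; []; [-]; _∷_)
open import Data.List.Relation.Unary.Unique.Propositional using (Unique; []; _∷_)
import Data.List.Relation.Unary.Unique.Propositional.Properties as Unique
open import Data.Nat using (ℕ; zero; suc; _≤_; _≥_; z≤n; s≤s; s≤s⁻¹; NonZero)
open import Data.Nat.Divisibility using (_∣?_)
open import Data.Nat.ListAction using (sum)
open import Data.Nat.Properties
  using (_≟_; ≤-refl; ≤-trans; +-mono-≤; m≤m+n; m≤n+m; m≤n⇒m≤1+n; 1+n≰n; m≤n⇒m<n∨m≡n)
open import Data.Product using (∃; _×_; _,_)
open import Data.Sum using (inj₁; inj₂)
open import Function.Bundles using (_⇔_; mk⇔)
open import Relation.Binary.PropositionalEquality using (_≡_; refl; sym; subst)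
open import Relation.Nullary using (Dec; yes; no; ¬?)
open import Relation.Nullary.Decidable using (map′)

record IsPartition (n : ℕ) (μ : List ℕ) : Set where
  constructor isPartition
  field
    nonincreasing : Linked _≥_ μ
    positive      : All (1 ≤_) μ
    total         : sum μ ≡ n

-- The nonincreasing lists of at most k positive parts, each at most m.
box : (m k : ℕ) → List (List ℕ)
box zero    _       = [] ∷ []
box (suc m) zero    = [] ∷ []
box (suc m) (suc k) = box m (suc k) ++ map (suc m ∷_) (box (suc m) k)

-- A partition of n has at most n parts, each at most n, so every partition
-- of n is listed exactly once: see ∈-partitions and partitions-unique.
partitions : ℕ → List (List ℕ)
partitions n = filter (λ μ → sum μ ≟ n) (box n n)

b : (ℓ n : ℕ) → ℕ
b ℓ n = length (filter (all? (λ part → ¬? (ℓ ∣? part))) (partitions n))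

private
  box-sound : ∀ m k {μ} → μ ∈ box m k →
              Linked _≥_ μ × All (1 ≤_) μ × All (_≤ m) μ
  box-sound zero    _       (here refl) = [] , [] , []
  box-sound (suc m) zero    (here refl) = [] , [] , []
  box-sound (suc m) (suc k) μ∈ with ∈-++⁻ (box m (suc k)) μ∈
  ... | inj₁ h with s , p , u ← box-sound m (suc k) h = s , p , All.map m≤n⇒m≤1+n u
  ... | inj₂ h with _ , ν∈ , refl ← ∈-map⁻ (suc m ∷_) h
               with s , p , u ← box-sound (suc m) k ν∈
               = cons u s , s≤s z≤n ∷ p , ≤-refl ∷ u
    where
    cons : ∀ {x ν} → All (_≤ x) ν → Linked _≥_ ν → Linked _≥_ (x ∷ ν)
    cons []      _ = [-]
    cons (h ∷ _) s = h ∷ s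

  head-bounds : ∀ {x ν} → Linked _≥_ (x ∷ ν) → All (_≤ x) ν
  head-bounds [-]     = []
  head-bounds (h ∷ s) = h ∷ All.map (λ q → ≤-trans q h) (head-bounds s)

  tail-sorted : ∀ {x ν} → Linked _≥_ (x ∷ ν) → Linked _≥_ ν
  tail-sorted [-]     = []
  tail-sorted (_ ∷ s) = s

  []∈box : ∀ m k → [] ∈ box m k
  []∈box zero    _       = here refl
  []∈box (suc m) zero    = here refl
  []∈box (suc m) (suc k) = ∈-++⁺ˡ ([]∈box m (suc k))

  box-complete : ∀ m k {μ} → Linked _≥_ μ → All (1 ≤_) μ → All (_≤ m) μ →
                 length μ ≤ k → μ ∈ box m k
  box-complete m       k       {[]}    _ _       _       _       = []∈box m k
  box-complete zero    _       {_ ∷ _} _ (p ∷ _) (q ∷ _) _       = ⊥-elim (1+n≰n (≤-trans p q))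
  box-complete (suc m) (suc k) {_ ∷ _} s (p ∷ ps) (q ∷ _) (s≤s l) with m≤n⇒m<n∨m≡n q
  ... | inj₁ q< = ∈-++⁺ˡ (box-complete m (suc k) s (p ∷ ps)
                    (s≤s⁻¹ q< ∷ All.map (λ r → ≤-trans r (s≤s⁻¹ q<)) (head-bounds s)) (s≤s l))
  ... | inj₂ refl = ∈-++⁺ʳ (box m (suc k))
                    (∈-map⁺ (suc m ∷_) (box-complete (suc m) k (tail-sorted s) ps (head-bounds s) l))

  box-unique : ∀ m k → Unique (box m k)
  box-unique zero    _       = [] ∷ []
  box-unique (suc m) zero    = [] ∷ []
  box-unique (suc m) (suc k) =
    Unique.++⁺ (box-unique m (suc k)) (Unique.map⁺ ∷-injectiveʳ (box-unique (suc m) k)) disjoint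
    where
    disjoint : Disjoint (box m (suc k)) (map (suc m ∷_) (box (suc m) k))
    disjoint (μ∈ , μ∈′) with _ , _ , refl ← ∈-map⁻ (suc m ∷_) μ∈′
                        with _ , _ , q ∷ _ ← box-sound m (suc k) μ∈ = 1+n≰n q

  length≤sum : ∀ {μ} → All (1 ≤_) μ → length μ ≤ sum μ
  length≤sum []       = z≤n
  length≤sum (p ∷ ps) = +-mono-≤ p (length≤sum ps)

  parts≤sum : ∀ μ → All (_≤ sum μ) μ
  parts≤sum []      = []
  parts≤sum (x ∷ μ) = m≤m+n x _ ∷ All.map (λ q → ≤-trans q (m≤n+m _ x)) (parts≤sum μ)

∈-partitions : ∀ {n μ} → μ ∈ partitions n ⇔ IsPartition n μ
∈-partitions {n} {μ} = mk⇔ to from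
  where
  to : μ ∈ partitions n → IsPartition n μ
  to h with μ∈ , eq ← ∈-filter⁻ (λ ν → sum ν ≟ n) {xs = box n n} h
       with s , p , _ ← box-sound n n μ∈ = isPartition s p eq
  from : IsPartition n μ → μ ∈ partitions n
  from (isPartition s p refl) =
    ∈-filter⁺ (λ ν → sum ν ≟ n) (box-complete n n s p (parts≤sum μ) (length≤sum p)) refl

partitions-unique : ∀ n → Unique (partitions n)
partitions-unique n = Unique.filter⁺ (λ μ → sum μ ≟ n) (box-unique n n)

IsSquareMod : ℕ → ℤ → Set
IsSquareMod p a = ∃ λ (x : ℤ) → + p ℤ∣.∣ x ℤ.* x ℤ.- a

isSquareMod? : ∀ p .{{_ : NonZero p}} a → Dec (IsSquareMod p a)
isSquareMod? p a = map′ (λ (i , h) → + toℕ i , h) reduce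
  (any? {n = p} λ i → + p ℤ∣.∣? + toℕ i ℤ.* + toℕ i ℤ.- a)
  where
  reduce : IsSquareMod p a → ∃ λ (i : Fin p) → + p ℤ∣.∣ + toℕ i ℤ.* + toℕ i ℤ.- a
  reduce (x , h) = fromℕ< r<p , subst (λ t → + p ℤ∣.∣ + t ℤ.* + t ℤ.- a) (sym (toℕ-fromℕ< r<p))
    (ℤ∣.∣m+n∣n⇒∣m (subst (+ p ℤ∣.∣_) expand h) (ℤ∣.∣n⇒∣m*n c ℤ∣.∣-refl))
    where
    r<p = n%ℕd<d x p
    r = + (x %ℕ p)
    q = x /ℕ p
    c = q ℤ.* (r ℤ.+ x)
    ring : ∀ r q p a → (r ℤ.+ q ℤ.* p) ℤ.* (r ℤ.+ q ℤ.* p) ℤ.- a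
                     ≡ (r ℤ.* r ℤ.- a) ℤ.+ q ℤ.* (r ℤ.+ (r ℤ.+ q ℤ.* p)) ℤ.* p
    ring = ℤ-Solver.solve-∀
    expand : x ℤ.* x ℤ.- a ≡ (r ℤ.* r ℤ.- a) ℤ.+ c ℤ.* + p
    expand = subst (λ y → y ℤ.* y ℤ.- a ≡ (r ℤ.* r ℤ.- a) ℤ.+ q ℤ.* (r ℤ.+ y) ℤ.* + p)
      (sym (a≡a%ℕn+[a/ℕn]*n x p)) (ring r q (+ p) a)

-- The Legendre symbol (a / p) when p is an odd prime.
legendre : ℤ → (p : ℕ) .{{_ : NonZero p}} → ℤ
legendre a p with + p ℤ∣.∣? a | isSquareMod? p a
... | yes _ | _     = 0ℤ
... | no  _ | yes _ = 1ℤ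
... | no  _ | no  _ = -1ℤ

{-# OPTIONS --safe #-}

-- Work with power series over 𝔽₂ and let θ c = ∑ q^(c (x² - 1) / 24), where x ≥ 0 runs over the integers with
-- integral exponent. Modulo 2 the pentagonal number theorem says ∏ (1 - q^n) = θ 1, so B = ∑ b 13 n q^n satisfies
-- B θ 1 = θ 13. Counting the solutions of x² + 3 y² = 4 (6 n + 1) and of 13 x² + 3 y² = 16 (6 n + 1) up to
-- involution gives θ 1 θ 3 = θ 4 and, for the exponents divisible by 4, (θ 13 θ 3)(4 n) = θ 4 (n); in both cases
-- the only solutions fixed by the involution come from square values of 6 n + 1. Hence B θ 4 = θ 13 θ 3, and
-- since θ 4 = θ 1 (q⁴), extracting every fourth coefficient gives (∑ b 13 (4 m) q^m) θ 1 = θ 4 = θ 3 θ 1.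
-- Cancelling θ 1 leaves ∑ b 13 (4 m) q^m = θ 3: b 13 (4 m) is odd exactly when 8 m + 1 is a square. In the
-- progressions of the theorem 8 m + 1 equals p^(2 α) times either p r with p not dividing r, or a quadratic
-- non-residue modulo p, so it is never a square.
module Submission where

open import Algebra.Bundles using (CommutativeSemiring)
import Algebra.Solver.Ring
import Algebra.Solver.Ring.Simple
open import Algebra.Solver.Ring.AlmostCommutativeRing
  using (AlmostCommutativeRing; _-Raw-AlmostCommutative⟶_; fromCommutativeRing; fromCommutativeSemiring)
open import Data.Bool using (Bool; true; false; _∧_; _xor_; not; T)
import Data.Bool.Properties as 𝔹
open import Data.Fin using (toℕ; fromℕ<)
import Data.Fin.Properties as Fin
open import Data.Integer as ℤ using (ℤ; +_; -[1+_]; 0ℤ; -1ℤ)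
open import Data.Integer.DivMod using (_%ℕ_; _/ℕ_; n%ℕd<d; a≡a%ℕn+[a/ℕn]*n)
import Data.Integer.Divisibility.Signed as ℤ∣
import Data.Integer.Properties as ℤ
import Data.Integer.Tactic.RingSolver as ℤ-Solver
open import Data.List using (List; []; _∷_; _++_; map; filter; length)
open import Data.List.Relation.Unary.All using (all?)
open import Data.Maybe using (Maybe; just; nothing)
open import Data.Nat using (ℕ; zero; suc; _+_; _*_; _∸_; _^_; _/_; _%_; _≤_; _<_; _≡ᵇ_; z≤n; s≤s; NonZero; >-nonZero; nonTrivial⇒n>1)
open import Data.Nat.DivMod using (m%n<n; m≡m%n+[m/n]*n; m*n/n≡m)
open import Data.Nat.Divisibility
  using (_∣_; _∤_; divides; _∣?_; ∣-refl; ∣-reflexive; ∣⇒≤; >⇒∤; m∣m*n; n∣m*n; ∣m⇒∣m*n; ∣n⇒∣m*n; ∣m∣n⇒∣m+n; ∣m+n∣m⇒∣n)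
open import Data.Nat.ListAction using (sum)
open import Data.Nat.Primality using (Prime; prime⇒nonZero; prime⇒nonTrivial; euclidsLemma)
import Data.Nat.Properties as ℕ
import Data.Nat.Solver
open import Data.Product using (∃; _×_; _,_; proj₁; proj₂)
open import Data.Sum using (_⊎_; inj₁; inj₂)
open import Defs using (b; box; legendre; IsSquareMod; isSquareMod?)
open import Function.Bundles using (_⇔_; mk⇔; Equivalence)
open import Level using (0ℓ)
open import Relation.Binary.Bundles using (Setoid)
open import Relation.Binary.PropositionalEquality
  using (_≡_; _≢_; refl; sym; trans; cong; cong₂; subst; subst₂; module ≡-Reasoning)
import Relation.Binary.Reasoning.Setoid as SetoidReasoning
open import Relation.Nullary using (¬_; yes; no; contradiction; does; ¬?; _⊎-dec_)
open import Relation.Nullary.Decidable using (from-no; from-yes; dec-true; dec-false; T?)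
open import Relation.Unary using (Pred; Decidable)

-- Multiplying by θ 3 clears a denominator: 1 / θ 1 = θ 3 / θ 4 with θ 4 a series in q⁴, so only θ
-- 13 θ 3 has to be dissected. What 1 and 13 share is that c + 3 = 4 s² with s a divisor of 2.
-- Substituting y = x - 4 s b in c x² + 3 y² then leaves 4 s² times x² - 3 t x b + 12 b² with s t =
-- 2, the norm form of a quadratic order of discriminant 9 t² - 48, which is -12 or -39. The
-- involution is conjugation in that order: it sends x to x - 3 t b and b to -b. A coefficient of θ
-- c records only whether an index is attained, so conjugation has to be made to act on the indices
-- u of the pairs (u, k - u). There x counts up to sign, while the sign of y must be chosen so that
-- 4 s divides x - y. No infinite product is formed. Product identities are proved for finite
-- products, with agreement below an explicit degree, and each coefficient is read off from a
-- truncation taken far enough out.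

-- Finite sums over the field with two elements.

module 𝔹-Solver = Algebra.Solver.Ring.Simple (fromCommutativeRing 𝔹.xor-∧-commutativeRing) 𝔹._≟_

-- Bool with _xor_ and _∧_ is the field 𝔽₂.
∑ : ℕ → (ℕ → Bool) → Bool
∑ zero    h = false
∑ (suc n) h = h 0 xor ∑ n (λ i → h (suc i))

∑-cong : ∀ n {g h} → (∀ i → i < n → g i ≡ h i) → ∑ n g ≡ ∑ n h
∑-cong zero    eq = refl
∑-cong (suc n) eq = cong₂ _xor_ (eq 0 (s≤s z≤n)) (∑-cong n (λ i i<n → eq (suc i) (s≤s i<n)))

∑-false : ∀ n → ∑ n (λ _ → false) ≡ false
∑-false zero    = refl
∑-false (suc n) = ∑-false n

∑-xor : ∀ n g h → ∑ n (λ i → g i xor h i) ≡ ∑ n g xor ∑ n h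
∑-xor zero    g h = refl
∑-xor (suc n) g h = trans (cong ((g 0 xor h 0) xor_) (∑-xor n _ _))
  (solve 4 (λ a b c d → (a :+ b) :+ (c :+ d) := (a :+ c) :+ (b :+ d)) refl (g 0) (h 0) _ _)
  where open 𝔹-Solver

∑-∧ˡ : ∀ n a h → ∑ n (λ i → a ∧ h i) ≡ a ∧ ∑ n h
∑-∧ˡ zero    a h = sym (𝔹.∧-zeroʳ a)
∑-∧ˡ (suc n) a h = trans (cong ((a ∧ h 0) xor_) (∑-∧ˡ n a _)) (sym (𝔹.∧-distribˡ-xor a (h 0) _))

∑-sucʳ : ∀ n h → ∑ (suc n) h ≡ ∑ n h xor h n
∑-sucʳ zero    h = 𝔹.xor-identityʳ (h 0)
∑-sucʳ (suc n) h = trans (cong (h 0 xor_) (∑-sucʳ n _)) (sym (𝔹.xor-assoc (h 0) _ _))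

-- Together with `∑-true` this turns a sum modulo 2 into an existence statement whenever at most one
-- index contributes.
∑-unique : ∀ n {h k} → k < n → T (h k) → (∀ i → i < n → T (h i) → i ≡ k) → ∑ n h ≡ true
∑-unique (suc n) {h} {zero} _ hk uniq =
  cong₂ _xor_ (Equivalence.to 𝔹.T-≡ hk) (trans (∑-cong n others) (∑-false n))
  where
  others : ∀ i → i < n → h (suc i) ≡ false
  others i i<n with h (suc i) in eq
  ... | false = refl
  ... | true  = contradiction (uniq (suc i) (s≤s i<n) (Equivalence.from 𝔹.T-≡ eq)) λ ()
∑-unique (suc n) {h} {suc k} (s≤s k<n) hk uniq with h 0 in eq
... | true  = contradiction (uniq 0 (s≤s z≤n) (Equivalence.from 𝔹.T-≡ eq)) λ ()
... | false = ∑-unique n k<n hk λ i i<n hi → ℕ.suc-injective (uniq (suc i) (s≤s i<n) hi)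

∑-true : ∀ n {h} → T (∑ n h) → ∃ λ i → i < n × T (h i)
∑-true (suc n) {h} t with h 0 in eq
... | true  = 0 , s≤s z≤n , Equivalence.from 𝔹.T-≡ eq
... | false with i , i<n , hi ← ∑-true n t = suc i , s≤s i<n , hi

-- The off-diagonal entries of a symmetric matrix cancel in pairs.
∑∑-symmetric : ∀ n (a : ℕ → ℕ → Bool) → (∀ i j → a i j ≡ a j i) →
               ∑ n (λ i → ∑ n (a i)) ≡ ∑ n (λ i → a i i)
∑∑-symmetric zero    a a-sym = refl
∑∑-symmetric (suc n) a a-sym = begin
  (a 0 0 xor r) xor ∑ n (λ i → a (suc i) 0 xor ∑ n (λ j → a (suc i) (suc j)))
    ≡⟨ cong ((a 0 0 xor r) xor_) (∑-xor n _ _) ⟩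
  (a 0 0 xor r) xor (∑ n (λ i → a (suc i) 0) xor m)
    ≡⟨ cong (λ c → (a 0 0 xor r) xor (c xor m)) (∑-cong n λ i _ → a-sym (suc i) 0) ⟩
  (a 0 0 xor r) xor (r xor m)
    ≡⟨ 𝔹.xor-assoc (a 0 0) r _ ⟩
  a 0 0 xor (r xor (r xor m))
    ≡⟨ cong (a 0 0 xor_) (trans (sym (𝔹.xor-assoc r r m)) (cong (_xor m) (𝔹.xor-same r))) ⟩
  a 0 0 xor m
    ≡⟨ cong (a 0 0 xor_) (∑∑-symmetric n _ λ i j → a-sym (suc i) (suc j)) ⟩
  a 0 0 xor ∑ n (λ i → a (suc i) (suc i)) ∎
  where
  open ≡-Reasoning
  r = ∑ n (λ j → a 0 (suc j))
  m = ∑ n (λ i → ∑ n (λ j → a (suc i) (suc j)))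

-- Formal power series over 𝔽₂; they and their equalities are records so that implicit series can be inferred.
record Series : Set where
  no-eta-equality
  constructor series
  field coeff : ℕ → Bool
open Series

infix  4 _≈_
infixl 6 _⊕_
infixl 7 _⊛_

record _≈_ (f g : Series) : Set where
  constructor pointwise
  field at : ∀ n → coeff f n ≡ coeff g n
open _≈_

tail : Series → Series
tail f .coeff n = coeff f (suc n)

const : Bool → Series
const a .coeff zero    = a
const a .coeff (suc _) = false

_⊕_ _⊛_ : Series → Series → Series
(f ⊕ g) .coeff n = coeff f n xor coeff g n
(f ⊛ g) .coeff n = ∑ (suc n) (λ i → coeff f i ∧ coeff g (n ∸ i))

scale : Bool → Series → Series
scale a f .coeff n = a ∧ coeff f n

≈-refl : ∀ {f} → f ≈ f
≈-refl .at n = refl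

≈-sym : ∀ {f g} → f ≈ g → g ≈ f
≈-sym p .at n = sym (at p n)

≈-trans : ∀ {f g h} → f ≈ g → g ≈ h → f ≈ h
≈-trans p q .at n = trans (at p n) (at q n)

⊛-cong : ∀ {f f′ g g′} → f ≈ f′ → g ≈ g′ → f ⊛ g ≈ f′ ⊛ g′
⊛-cong p q .at n = ∑-cong (suc n) λ i _ → cong₂ _∧_ (at p i) (at q (n ∸ i))

⊛-distribʳ-⊕ : ∀ h f g → (f ⊕ g) ⊛ h ≈ f ⊛ h ⊕ g ⊛ h
⊛-distribʳ-⊕ h f g .at n = trans
  (∑-cong (suc n) λ i _ → 𝔹.∧-distribʳ-xor (coeff h (n ∸ i)) (coeff f i) (coeff g i))
  (∑-xor (suc n) (λ i → coeff f i ∧ coeff h (n ∸ i)) (λ i → coeff g i ∧ coeff h (n ∸ i)))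

scale-⊛ : ∀ a f g → scale a f ⊛ g ≈ scale a (f ⊛ g)
scale-⊛ a f g .at n = trans
  (∑-cong (suc n) λ i _ → 𝔹.∧-assoc a (coeff f i) (coeff g (n ∸ i)))
  (∑-∧ˡ (suc n) a λ i → coeff f i ∧ coeff g (n ∸ i))

-- A convolution unfolds along its left factor only. Commuting `tail f ⊛ g` by induction exposes the
-- head of `g`; what remains is the product of the two tails, two degrees lower, hence two base
-- cases.
⊛-comm-at : ∀ n f g → coeff (f ⊛ g) n ≡ coeff (g ⊛ f) n
⊛-comm-at zero    f g = cong (_xor false) (𝔹.∧-comm (coeff f 0) (coeff g 0))
⊛-comm-at (suc zero) f g =
  solve 4 (λ a b c d → a :* b :+ (c :* d :+ con false) := d :* c :+ (b :* a :+ con false)) refl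
    (coeff f 0) (coeff g 1) (coeff f 1) (coeff g 0)
  where open 𝔹-Solver
⊛-comm-at (suc (suc n)) f g = begin
  f₀ ∧ coeff g (2 + n) xor coeff (tail f ⊛ g) (suc n)
    ≡⟨ cong (f₀ ∧ coeff g (2 + n) xor_) (⊛-comm-at (suc n) (tail f) g) ⟩
  f₀ ∧ coeff g (2 + n) xor (g₀ ∧ coeff f (2 + n) xor coeff (tail g ⊛ tail f) n)
    ≡⟨ cong (λ t → f₀ ∧ coeff g (2 + n) xor (g₀ ∧ coeff f (2 + n) xor t)) (⊛-comm-at n (tail g) (tail f)) ⟩
  f₀ ∧ coeff g (2 + n) xor (g₀ ∧ coeff f (2 + n) xor coeff (tail f ⊛ tail g) n)
    ≡⟨ solve 3 (λ a b c → a :+ (b :+ c) := b :+ (a :+ c)) refl (f₀ ∧ coeff g (2 + n)) (g₀ ∧ coeff f (2 + n)) _ ⟩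
  g₀ ∧ coeff f (2 + n) xor (f₀ ∧ coeff g (2 + n) xor coeff (tail f ⊛ tail g) n)
    ≡⟨ cong (g₀ ∧ coeff f (2 + n) xor_) (⊛-comm-at (suc n) f (tail g)) ⟩
  g₀ ∧ coeff f (2 + n) xor coeff (tail g ⊛ f) (suc n) ∎
  where
  open ≡-Reasoning
  open 𝔹-Solver
  f₀ = coeff f 0
  g₀ = coeff g 0

⊛-comm : ∀ f g → f ⊛ g ≈ g ⊛ f
⊛-comm f g .at n = ⊛-comm-at n f g

⊛-assoc-at : ∀ n f g h → coeff ((f ⊛ g) ⊛ h) n ≡ coeff (f ⊛ (g ⊛ h)) n
⊛-assoc-at zero f g h =
  solve 3 (λ a b c → (a :* b :+ con false) :* c :+ con false := a :* (b :* c :+ con false) :+ con false) refl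
    (coeff f 0) (coeff g 0) (coeff h 0)
  where open 𝔹-Solver
⊛-assoc-at (suc n) f g h = begin
  fg₀ ∧ coeff h (suc n) xor coeff (tail (f ⊛ g) ⊛ h) n
    -- The tail of `f ⊛ g` is `scale f₀ (tail g) ⊕ tail f ⊛ g` by definition.
    ≡⟨ cong (fg₀ ∧ coeff h (suc n) xor_) (at (⊛-distribʳ-⊕ h (scale f₀ (tail g)) (tail f ⊛ g)) n) ⟩
  fg₀ ∧ coeff h (suc n) xor (coeff (scale f₀ (tail g) ⊛ h) n xor coeff ((tail f ⊛ g) ⊛ h) n)
    ≡⟨ cong (fg₀ ∧ coeff h (suc n) xor_)
         (cong₂ _xor_ (at (scale-⊛ f₀ (tail g) h) n) (⊛-assoc-at n (tail f) g h)) ⟩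
  fg₀ ∧ coeff h (suc n) xor (f₀ ∧ coeff (tail g ⊛ h) n xor coeff (tail f ⊛ (g ⊛ h)) n)
    ≡⟨ solve 5 (λ a b c d e → (a :* b :+ con false) :* c :+ (a :* d :+ e) := a :* (b :* c :+ d) :+ e) refl
         f₀ (coeff g 0) (coeff h (suc n)) _ _ ⟩
  f₀ ∧ (coeff g 0 ∧ coeff h (suc n) xor coeff (tail g ⊛ h) n) xor coeff (tail f ⊛ (g ⊛ h)) n ∎
  where
  open ≡-Reasoning
  open 𝔹-Solver
  f₀ = coeff f 0
  fg₀ = coeff (f ⊛ g) 0

⊛-assoc : ∀ f g h → (f ⊛ g) ⊛ h ≈ f ⊛ (g ⊛ h)
⊛-assoc f g h .at n = ⊛-assoc-at n f g h

const-⊛ : ∀ a f → const a ⊛ f ≈ scale a f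
const-⊛ a f .at zero    = 𝔹.xor-identityʳ _
const-⊛ a f .at (suc n) = trans (cong ((a ∧ coeff f (suc n)) xor_) (∑-false (suc n))) (𝔹.xor-identityʳ _)

⊛-identityˡ : ∀ f → const true ⊛ f ≈ f
⊛-identityˡ f .at = at (const-⊛ true f)

⊛-zeroˡ : ∀ f → const false ⊛ f ≈ const false
⊛-zeroˡ f .at zero    = refl
⊛-zeroˡ f .at (suc n) = at (const-⊛ false f) (suc n)

series-commutativeSemiring : CommutativeSemiring 0ℓ 0ℓ
series-commutativeSemiring = record
  { Carrier = Series ; _≈_ = _≈_ ; _+_ = _⊕_ ; _*_ = _⊛_ ; 0# = const false ; 1# = const true
  ; isCommutativeSemiring = record
    { isSemiring = record
      { isSemiringWithoutAnnihilatingZero = record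
        { +-isCommutativeMonoid = record
          { isMonoid = record
            { isSemigroup = record
              { isMagma = record
                { isEquivalence = record { refl = ≈-refl ; sym = ≈-sym ; trans = ≈-trans }
                ; ∙-cong = λ p q → pointwise λ n → cong₂ _xor_ (at p n) (at q n) }
              ; assoc = λ f g h → pointwise λ n → 𝔹.xor-assoc (coeff f n) (coeff g n) (coeff h n) }
            ; identity = ⊕-identityˡ , λ f → ≈-trans (⊕-comm f (const false)) (⊕-identityˡ f) }
          ; comm = ⊕-comm }
        ; *-cong = ⊛-cong
        ; *-assoc = ⊛-assoc
        ; *-identity = ⊛-identityˡ , λ f → ≈-trans (⊛-comm f _) (⊛-identityˡ f)
        ; distrib = (λ h f g → ≈-trans (⊛-comm h _) (≈-trans (⊛-distribʳ-⊕ h f g)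
                       (pointwise λ n → cong₂ _xor_ (at (⊛-comm f h) n) (at (⊛-comm g h) n))))
                  , ⊛-distribʳ-⊕ }
      ; zero = ⊛-zeroˡ , λ f → ≈-trans (⊛-comm f _) (⊛-zeroˡ f) }
    ; *-comm = ⊛-comm } }
  where
  ⊕-comm : ∀ f g → f ⊕ g ≈ g ⊕ f
  ⊕-comm f g .at n = 𝔹.xor-comm (coeff f n) (coeff g n)
  ⊕-identityˡ : ∀ f → const false ⊕ f ≈ f
  ⊕-identityˡ f .at zero    = refl
  ⊕-identityˡ f .at (suc n) = refl

open CommutativeSemiring series-commutativeSemiring using ()
  renaming (+-cong to ⊕-cong; +-assoc to ⊕-assoc; +-comm to ⊕-comm; *-identityʳ to ⊛-identityʳ)

module ≈-Reasoning = SetoidReasoning (CommutativeSemiring.setoid series-commutativeSemiring)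

𝔹-ring series-ring : AlmostCommutativeRing 0ℓ 0ℓ
𝔹-ring      = fromCommutativeRing 𝔹.xor-∧-commutativeRing
series-ring = fromCommutativeSemiring series-commutativeSemiring

const-homomorphism : AlmostCommutativeRing.rawRing 𝔹-ring -Raw-AlmostCommutative⟶ series-ring
const-homomorphism = record
  { ⟦_⟧    = const
  ; +-homo = λ a b → pointwise λ { zero → refl ; (suc n) → refl }
  ; *-homo = λ a b → ≈-sym (≈-trans (const-⊛ a (const b))
               (pointwise λ { zero → refl ; (suc n) → 𝔹.∧-zeroʳ a }))
  ; -‿homo = λ a → ≈-refl
  ; 0-homo = ≈-refl
  ; 1-homo = ≈-refl
  }

const-≟ : ∀ a b → Maybe (const a ≈ const b)
const-≟ true  true  = just ≈-refl
const-≟ false false = just ≈-refl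
const-≟ _     _     = nothing

-- With coefficients in 𝔽₂ the solver also decides identities that need f + f = 0.
module Series-Solver = Algebra.Solver.Ring (AlmostCommutativeRing.rawRing 𝔹-ring) series-ring const-homomorphism const-≟

-- Agreement of series below a given degree; cancellation, shifts and monomials.

infix 4 _≈[_]_
record _≈[_]_ (f : Series) (n : ℕ) (g : Series) : Set where
  constructor below
  field at[] : ∀ i → i < n → coeff f i ≡ coeff g i
open _≈[_]_

≈⇒≈[] : ∀ {n f g} → f ≈ g → f ≈[ n ] g
≈⇒≈[] eq .at[] i _ = at eq i

≈[]-setoid : ℕ → Setoid 0ℓ 0ℓ
≈[]-setoid n = record
  { Carrier = Series ; _≈_ = _≈[ n ]_
  ; isEquivalence = record
    { refl  = below λ _ _ → refl
    ; sym   = λ p → below λ i i<n → sym (at[] p i i<n)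
    ; trans = λ p q → below λ i i<n → trans (at[] p i i<n) (at[] q i i<n) } }

module ≈[]-Reasoning (n : ℕ) = SetoidReasoning (≈[]-setoid n)

≈[]-refl : ∀ {n f} → f ≈[ n ] f
≈[]-refl {n} = Setoid.refl (≈[]-setoid n)

≈[]-mono : ∀ {m n f g} → m ≤ n → f ≈[ n ] g → f ≈[ m ] g
≈[]-mono m≤n p .at[] i i<m = at[] p i (ℕ.<-≤-trans i<m m≤n)

⊕-cong[] : ∀ {n f f′ g g′} → f ≈[ n ] f′ → g ≈[ n ] g′ → f ⊕ g ≈[ n ] f′ ⊕ g′
⊕-cong[] p q .at[] i i<n = cong₂ _xor_ (at[] p i i<n) (at[] q i i<n)

⊛-cong[] : ∀ {n f f′ g g′} → f ≈[ n ] f′ → g ≈[ n ] g′ → f ⊛ g ≈[ n ] f′ ⊛ g′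
⊛-cong[] p q .at[] m m<n = ∑-cong (suc m) λ i i≤m → cong₂ _∧_
  (at[] p i (ℕ.<-≤-trans i≤m m<n)) (at[] q (m ∸ i) (ℕ.≤-<-trans (ℕ.m∸n≤m m i) m<n))

inverse-unique[] : ∀ {n f g h} → f ⊛ h ≈[ n ] const true → g ⊛ h ≈[ n ] const true → f ≈[ n ] g
inverse-unique[] {n} {f} {g} {h} fh gh = begin
  f               ≈⟨ ≈⇒≈[] (⊛-identityʳ f) ⟨
  f ⊛ const true  ≈⟨ ⊛-cong[] ≈[]-refl gh ⟨
  f ⊛ (g ⊛ h)     ≈⟨ ≈⇒≈[] (solve 3 (λ f g h → f :* (g :* h) := (f :* h) :* g) ≈-refl f g h) ⟩
  (f ⊛ h) ⊛ g     ≈⟨ ⊛-cong[] fh ≈[]-refl ⟩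
  const true ⊛ g  ≈⟨ ≈⇒≈[] (⊛-identityˡ g) ⟩
  g               ∎
  where
  open ≈[]-Reasoning n
  open Series-Solver

-- Degree 0 shows that the constant terms agree; removing their contribution from both sides leaves
-- the same equation for the tails.
⊛-cancelʳ : ∀ {f g h} → coeff h 0 ≡ true → f ⊛ h ≈ g ⊛ h → f ≈ g
⊛-cancelʳ {f} {g} {h} h₀ eq = pointwise λ n → go n f g (at eq)
  where
  go : ∀ n f g → (∀ n → coeff (f ⊛ h) n ≡ coeff (g ⊛ h) n) → coeff f n ≡ coeff g n
  head≡ : ∀ f g → (∀ n → coeff (f ⊛ h) n ≡ coeff (g ⊛ h) n) → coeff f 0 ≡ coeff g 0
  head≡ f g eq = trans (sym (unit f)) (trans (eq 0) (unit g))
    where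
    unit : ∀ f → coeff (f ⊛ h) 0 ≡ coeff f 0
    unit f rewrite h₀ = trans (𝔹.xor-identityʳ _) (𝔹.∧-identityʳ _)
  go zero    f g eq = head≡ f g eq
  go (suc n) f g eq = go n (tail f) (tail g) λ k → xor-cancelˡ (coeff f 0 ∧ coeff h (suc k))
    (trans (eq (suc k)) (cong (λ a → a ∧ coeff h (suc k) xor coeff (tail g ⊛ h) k) (sym (head≡ f g eq))))
    where
    xor-cancelˡ : ∀ a {b c} → a xor b ≡ a xor c → b ≡ c
    xor-cancelˡ false eq = eq
    xor-cancelˡ true  eq = 𝔹.not-injective eq

shift : ℕ → Series → Series
shift zero    f = f
shift (suc e) f .coeff zero    = false
shift (suc e) f .coeff (suc n) = coeff (shift e f) n

shift-cong[] : ∀ e {n f g} → f ≈[ n ] g → shift e f ≈[ e + n ] shift e g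
shift-cong[] zero    p                             = p
shift-cong[] (suc e) p .at[] zero    _             = refl
shift-cong[] (suc e) p .at[] (suc i) (s≤s i<n)     = at[] (shift-cong[] e p) i i<n

mono : ℕ → Series
mono e .coeff n = e ≡ᵇ n

mono-⊛ : ∀ e f → mono e ⊛ f ≈ shift e f
mono-⊛ zero    f = ≈-trans (⊛-cong (pointwise λ { zero → refl ; (suc n) → refl }) ≈-refl) (⊛-identityˡ f)
mono-⊛ (suc e) f .at zero    = refl
mono-⊛ (suc e) f .at (suc n) = at (mono-⊛ e f) n

shift-< : ∀ e f {n} → n < e → coeff (shift e f) n ≡ false
shift-< (suc e) f {zero}  _         = refl
shift-< (suc e) f {suc n} (s≤s n<e) = shift-< e f n<e

mono-0 : mono 0 ≈ const true
mono-0 .at zero    = refl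
mono-0 .at (suc n) = refl

mono-+ : ∀ d e → mono (d + e) ≈ mono d ⊛ mono e
mono-+ d e = ≈-trans (≈-sym (shift-mono d)) (≈-sym (mono-⊛ d (mono e)))
  where
  shift-mono : ∀ d → shift d (mono e) ≈ mono (d + e)
  shift-mono zero    = ≈-refl
  shift-mono (suc d) .at zero    = refl
  shift-mono (suc d) .at (suc n) = at (shift-mono d) n

-- Squares, triangular numbers and theta series.

module ℕ-Solver = Data.Nat.Solver.+-*-Solver

T-ext : ∀ {a b} → (T a → T b) → (T b → T a) → a ≡ b
T-ext {false} {false} f g = refl
T-ext {false} {true}  f g with () ← g _
T-ext {true}  {false} f g with () ← f _
T-ext {true}  {true}  f g = refl

¬T⇒false : ∀ {a} → ¬ T a → a ≡ false
¬T⇒false {false} _ = refl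
¬T⇒false {true}  f = contradiction _ f

*-self-cancel-≤ : ∀ {x y} → x * x ≤ y * y → x ≤ y
*-self-cancel-≤ {x} {y} le with x Data.Nat.≤? y
... | yes x≤y = x≤y
... | no  x≰y = contradiction (ℕ.*-mono-< (ℕ.≰⇒> x≰y) (ℕ.≰⇒> x≰y)) (ℕ.≤⇒≯ le)

*-self-injective : ∀ {x y} → x * x ≡ y * y → x ≡ y
*-self-injective eq = ℕ.≤-antisym (*-self-cancel-≤ (ℕ.≤-reflexive eq)) (*-self-cancel-≤ (ℕ.≤-reflexive (sym eq)))

tri : ℕ → ℕ
tri zero    = 0
tri (suc n) = suc n + tri n

2*tri : ∀ n → 2 * tri n ≡ n * suc n
2*tri zero    = refl
2*tri (suc n) = trans (ℕ.*-distribˡ-+ 2 (suc n) (tri n)) (trans (cong (λ m → 2 * suc n + m) (2*tri n))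
  (solve 1 (λ n → con 2 :* (con 1 :+ n) :+ n :* (con 1 :+ n) := (con 1 :+ n) :* (con 2 :+ n)) refl n))
  where open ℕ-Solver

-- The condition c (x² - 1) / 24 = n, cleared of division and subtraction.
hit : ℕ → ℕ → ℕ → Bool
hit c n x = c * (x * x) ≡ᵇ 24 * n + c

hit⁺ : ∀ c n x → c * (x * x) ≡ 24 * n + c → T (hit c n x)
hit⁺ c n x = ℕ.≡⇒≡ᵇ (c * (x * x)) (24 * n + c)

hit⁻ : ∀ c n x → T (hit c n x) → c * (x * x) ≡ 24 * n + c
hit⁻ c n x = ℕ.≡ᵇ⇒≡ (c * (x * x)) (24 * n + c)

∑-hit : ∀ {c n x B} → 1 ≤ c → x < B → c * (x * x) ≡ 24 * n + c → T (∑ B (hit c n))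
∑-hit {c} {n} {x} {B} 1≤c x<B eq = Equivalence.from 𝔹.T-≡
  (∑-unique B x<B (hit⁺ c n x eq) λ i _ hi → *-self-injective
    (ℕ.*-cancelˡ-≡ (i * i) (x * x) c {{>-nonZero 1≤c}} (trans (hit⁻ c n i hi) (sym eq))))

-- The coefficients of q^(-c/24) ∑ q^(c x² / 24), summed over the x ≥ 0 that give integral exponents.
-- By the pentagonal number theorem θ 1 is ∏ (1 - q^n) modulo 2; also θ 3 = ∑ q^(k (k + 1) / 2).
abstract
  θ : ℕ → Series
  θ c .coeff n = ∑ (suc (24 * n + c)) (hit c n)

  -- Every root lies below the summation bound of `θ`, since x ≤ x² ≤ c x² = 24 n + c.
  θ⁺ : ∀ {c n} x → 1 ≤ c → c * (x * x) ≡ 24 * n + c → T (coeff (θ c) n)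
  θ⁺ {c} {n} x 1≤c eq = ∑-hit {c} {n} 1≤c (s≤s (ℕ.≤-trans (x≤x*x x) (ℕ.≤-trans (ℕ.m≤n*m (x * x) c {{>-nonZero 1≤c}}) (ℕ.≤-reflexive eq)))) eq
    where
    x≤x*x : ∀ x → x ≤ x * x
    x≤x*x zero    = z≤n
    x≤x*x (suc x) = ℕ.m≤m+n (suc x) (x * suc x)

  θ⁻ : ∀ {c n} → T (coeff (θ c) n) → ∃ λ x → c * (x * x) ≡ 24 * n + c
  θ⁻ {c} {n} t with x , _ , h ← ∑-true (suc (24 * n + c)) t = x , hit⁻ c n x h

-- Shanks' finite form of the pentagonal number theorem, in the variable q^c.
module Pentagonal (c : ℕ) where

  x : ℕ → Series
  x e = mono (c * e)

  x-+ : ∀ d e → x (d + e) ≈ x d ⊛ x e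
  x-+ d e rewrite ℕ.*-distribˡ-+ c d e = mono-+ (c * d) (c * e)

  x-0 : x 0 ≈ const true
  x-0 rewrite ℕ.*-zeroʳ c = mono-0

  x-≡ : ∀ {d e} → d ≡ e → x d ≈ x e
  x-≡ refl = ≈-refl

  factor : ℕ → Series
  factor e = const true ⊕ x e

  -- The product of 1 - x^i over s < i ≤ s + k.
  Π : ℕ → ℕ → Series
  Π s zero    = const true
  Π s (suc k) = factor (suc (s + k)) ⊛ Π s k

  Π-bottom : ∀ s k → Π s (suc k) ≈ factor (suc s) ⊛ Π (suc s) k
  Π-bottom s zero rewrite ℕ.+-identityʳ s = ≈-refl
  Π-bottom s (suc k) = begin
    factor (suc (s + suc k)) ⊛ Π s (suc k)
      ≈⟨ ⊛-cong ≈-refl (Π-bottom s k) ⟩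
    factor (suc (s + suc k)) ⊛ (factor (suc s) ⊛ Π (suc s) k)
      ≈⟨ solve 3 (λ a b c → a :* (b :* c) := b :* (a :* c)) ≈-refl _ _ _ ⟩
    factor (suc s) ⊛ (factor (suc (s + suc k)) ⊛ Π (suc s) k)
      ≡⟨ cong (λ e → factor (suc s) ⊛ (factor (suc e) ⊛ Π (suc s) k)) (ℕ.+-suc s k) ⟩
    factor (suc s) ⊛ (factor (suc (suc s + k)) ⊛ Π (suc s) k) ∎
    where
    open ≈-Reasoning
    open Series-Solver

  term : ℕ → ℕ → Series
  term s k = Π s k ⊛ x (s * (s + k) + tri s)

  -- terms s k is the part s ≤ i ≤ n of Shanks' sum ∑ (Π 0 n / Π 0 i) x^(i n + i (i + 1) / 2), where n = s + k.
  terms : ℕ → ℕ → Series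
  terms s zero    = term s 0
  terms s (suc k) = term s (suc k) ⊕ terms (suc s) k

  -- With j = m + 1 the exponents are the pentagonal numbers j (3 j - 1) / 2 and j (3 j + 1) / 2.
  pent : ℕ → Series
  pent m = x (suc m * m + tri (suc m)) ⊕ x (suc m * suc m + tri (suc m))

  term-suc : ∀ s k → term s (suc k) ≈ x s ⊛ (factor (suc (s + k)) ⊛ term s k)
  term-suc s k = begin
    (factor (suc (s + k)) ⊛ Π s k) ⊛ x (s * (s + suc k) + tri s)
      ≈⟨ ⊛-cong ≈-refl (≈-trans (x-≡ exponent) (x-+ s _)) ⟩
    (factor (suc (s + k)) ⊛ Π s k) ⊛ (x s ⊛ x (s * (s + k) + tri s))
      ≈⟨ solve 4 (λ a b c d → (a :* b) :* (c :* d) := c :* (a :* (b :* d))) ≈-refl _ _ _ _ ⟩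
    x s ⊛ (factor (suc (s + k)) ⊛ (Π s k ⊛ x (s * (s + k) + tri s))) ∎
    where
    open ≈-Reasoning
    open Series-Solver
    exponent : s * (s + suc k) + tri s ≡ s + (s * (s + k) + tri s)
    exponent = ℕ-Solver.solve 3 (λ s k t → s ℕ-Solver.:* (s ℕ-Solver.:+ (ℕ-Solver.con 1 ℕ-Solver.:+ k)) ℕ-Solver.:+ t
      ℕ-Solver.:= s ℕ-Solver.:+ (s ℕ-Solver.:* (s ℕ-Solver.:+ k) ℕ-Solver.:+ t)) refl s k (tri s)

  exponent-suc : ∀ s k → s + (suc (s + k) + (s * (s + k) + tri s)) ≡ suc s * (s + k) + tri (suc s)
  exponent-suc s k = solve 3 (λ s k t → s :+ (con 1 :+ (s :+ k) :+ (s :* (s :+ k) :+ t))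
                                  := (con 1 :+ s) :* (s :+ k) :+ (con 1 :+ s :+ t)) refl s k (tri s)
    where open ℕ-Solver

  -- Passing to the sums that start at s makes an induction possible, at the cost of the error
  -- `factor s ⊛ term s k`. The error vanishes at s = 0, where `factor 0` is 1 + 1.
  terms-suc : ∀ s k → terms s (suc k) ≈ terms s k ⊕ (factor s ⊛ term s k ⊕ pent (s + k))
  terms-suc s zero = begin
    term s 1 ⊕ term (suc s) 0
      ≈⟨ ⊕-cong (term-suc s 0) (⊛-identityˡ _) ⟩
    x s ⊛ ((const true ⊕ x (suc (s + 0))) ⊛ (const true ⊛ y)) ⊕ z
      ≈⟨ solve 4 (λ a b y z → a :* ((con true :+ b) :* (con true :* y)) :+ z
           := con true :* y :+ ((con true :+ a) :* (con true :* y) :+ (a :* (b :* y) :+ z))) ≈-refl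
           (x s) (x (suc (s + 0))) y z ⟩
    term s 0 ⊕ (factor s ⊛ term s 0 ⊕ (x s ⊛ (x (suc (s + 0)) ⊛ y) ⊕ z))
      ≈⟨ ⊕-cong ≈-refl (⊕-cong ≈-refl (⊕-cong
           (≈-trans (⊛-cong ≈-refl (≈-sym (x-+ (suc (s + 0)) _))) (≈-trans (≈-sym (x-+ s _)) (x-≡ (trans (exponent-suc s 0) (cong (λ e → suc s * e + tri (suc s)) (ℕ.+-identityʳ s))))))
           (x-≡ (cong (λ e → suc s * suc e + tri (suc s)) (ℕ.+-identityʳ s))))) ⟩
    term s 0 ⊕ (factor s ⊛ term s 0 ⊕ pent s)
      ≡⟨ cong (λ e → term s 0 ⊕ (factor s ⊛ term s 0 ⊕ pent e)) (sym (ℕ.+-identityʳ s)) ⟩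
    term s 0 ⊕ (factor s ⊛ term s 0 ⊕ pent (s + 0)) ∎
    where
    open ≈-Reasoning
    open Series-Solver
    y = x (s * (s + 0) + tri s)
    z = x (suc s * (suc s + 0) + tri (suc s))
  terms-suc s (suc k) = begin
    term s (2 + k) ⊕ terms (suc s) (suc k)
      ≈⟨ ⊕-cong (term-suc s (suc k)) (terms-suc (suc s) k) ⟩
    x s ⊛ (factor (suc (s + suc k)) ⊛ t) ⊕ (u ⊕ (factor (suc s) ⊛ term (suc s) k ⊕ pent (suc s + k)))
      ≈⟨ ⊕-cong ≈-refl (⊕-cong ≈-refl (⊕-cong next ≈-refl)) ⟩
    x s ⊛ (factor (suc (s + suc k)) ⊛ t) ⊕ (u ⊕ (x s ⊛ (x (suc (s + suc k)) ⊛ t) ⊕ pent (suc s + k)))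
      ≈⟨ solve 5 (λ a b t u p → a :* ((con true :+ b) :* t) :+ (u :+ (a :* (b :* t) :+ p))
           := t :+ u :+ ((con true :+ a) :* t :+ p)) ≈-refl (x s) (x (suc (s + suc k))) t u (pent (suc s + k)) ⟩
    (t ⊕ u) ⊕ (factor s ⊛ t ⊕ pent (suc s + k))
      ≡⟨ cong (λ e → (t ⊕ u) ⊕ (factor s ⊛ t ⊕ pent e)) (sym (ℕ.+-suc s k)) ⟩
    (t ⊕ u) ⊕ (factor s ⊛ t ⊕ pent (s + suc k)) ∎
    where
    open ≈-Reasoning
    open Series-Solver
    t = term s (suc k)
    u = terms (suc s) k
    e = s * (s + suc k) + tri s
    exponent : suc s * (suc s + k) + tri (suc s) ≡ s + (suc (s + suc k) + e)
    exponent = trans (cong (λ j → suc s * j + tri (suc s)) (sym (ℕ.+-suc s k))) (sym (exponent-suc s (suc k)))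
    -- This error of the induction hypothesis cancels half of `term-suc s (suc k)`. What is left is
    -- `x s ⊛ t`, which equals `t ⊕ factor s ⊛ t`.
    next : factor (suc s) ⊛ term (suc s) k ≈ x s ⊛ (x (suc (s + suc k)) ⊛ t)
    next = begin
      factor (suc s) ⊛ (Π (suc s) k ⊛ x (suc s * (suc s + k) + tri (suc s)))
        ≈⟨ ⊛-cong ≈-refl (⊛-cong ≈-refl (≈-trans (x-≡ exponent)
             (≈-trans (x-+ s _) (⊛-cong ≈-refl (x-+ (suc (s + suc k)) e))))) ⟩
      factor (suc s) ⊛ (Π (suc s) k ⊛ (x s ⊛ (x (suc (s + suc k)) ⊛ x e)))
        ≈⟨ solve 5 (λ f p a b y → f :* (p :* (a :* (b :* y))) := a :* (b :* ((f :* p) :* y))) ≈-refl _ _ _ _ _ ⟩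
      x s ⊛ (x (suc (s + suc k)) ⊛ ((factor (suc s) ⊛ Π (suc s) k) ⊛ x e))
        ≈⟨ ⊛-cong ≈-refl (⊛-cong ≈-refl (⊛-cong (≈-sym (Π-bottom s k)) ≈-refl)) ⟩
      x s ⊛ (x (suc (s + suc k)) ⊛ t) ∎

  shanks : ∀ n → terms 0 (suc n) ≈ terms 0 n ⊕ pent n
  shanks n = ≈-trans (terms-suc 0 n) (⊕-cong ≈-refl (≈-trans
    (⊕-cong (⊛-cong (⊕-cong ≈-refl x-0) ≈-refl) ≈-refl)
    (solve 2 (λ t p → (con true :+ con true) :* t :+ p := p) ≈-refl _ _)))
    where open Series-Solver

  x-below : ∀ f e {n} → n < c * e → coeff (f ⊛ x e) n ≡ false
  x-below f e n<ce = trans (at (≈-trans (⊛-comm f (x e)) (mono-⊛ (c * e) f)) _) (shift-< (c * e) f n<ce)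

  -- In the sum for n a summand with index i ≥ 1 starts at degree c (i n + i (i + 1) / 2), which
  -- exceeds c n. Up to degree c n only the summand `Π 0 n` survives.
  terms-below : 1 ≤ c → ∀ s k {n} → n < suc (c * (suc s + k)) → coeff (terms (suc s) k) n ≡ false
  term-below : 1 ≤ c → ∀ s k {n} → n < suc (c * (suc s + k)) → coeff (term (suc s) k) n ≡ false
  term-below 1≤c s k {n} (s≤s n≤) = x-below (Π (suc s) k) _ (begin-strict
    n                                                          ≤⟨ n≤ ⟩
    c * (suc s + k)                                            <⟨ ℕ.*-monoʳ-< c {{>-nonZero 1≤c}} (ℕ.n<1+n _) ⟩
    c * suc (suc s + k)                                        ≡⟨ cong (c *_) (ℕ.+-comm 1 _) ⟩
    c * (suc s + k + 1)                                        ≤⟨ ℕ.*-monoʳ-≤ c (ℕ.+-mono-≤ (ℕ.m≤m+n (suc s + k) _) (s≤s z≤n)) ⟩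
    c * (suc s * (suc s + k) + tri (suc s))                    ∎)
    where open ℕ.≤-Reasoning
  terms-below 1≤c s zero    n< = term-below 1≤c s 0 n<
  terms-below 1≤c s (suc k) {n} n< = cong₂ _xor_ (term-below 1≤c s (suc k) n<)
    (terms-below 1≤c (suc s) k (subst (λ e → n < suc (c * e)) (ℕ.+-suc (suc s) k) n<))

  Π≈terms : 1 ≤ c → ∀ n → Π 0 n ≈[ suc (c * n) ] terms 0 n
  Π≈terms 1≤c n .at[] i i< = trans (sym (at term-0 i)) (sym (go n i<))
    where
    term-0 : term 0 n ≈ Π 0 n
    term-0 = ≈-trans (⊛-cong ≈-refl x-0) (⊛-identityʳ (Π 0 n))
    go : ∀ n → i < suc (c * n) → coeff (terms 0 n) i ≡ coeff (term 0 n) i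
    go zero    i< = refl
    go (suc n) i< = trans (cong (coeff (term 0 (suc n)) i xor_) (terms-below 1≤c 0 n i<)) (𝔹.xor-identityʳ _)

  module _ (2∤c : 2 ∤ c) (3∤c : 3 ∤ c) where

    1≤c : 1 ≤ c
    1≤c = ℕ.n≢0⇒n>0 λ { refl → 2∤c (divides 0 refl) }

    hit-pentagonal : ∀ n y e → y * y ≡ 24 * e + 1 → hit c n y ≡ coeff (x e) n
    hit-pentagonal n y e eq = T-ext
      (λ t → ℕ.≡⇒≡ᵇ (c * e) n (ℕ.*-cancelˡ-≡ (c * e) n 24 (ℕ.+-cancelʳ-≡ c _ _ (trans (sym expand) (hit⁻ c n y t)))))
      (λ t → hit⁺ c n y (trans expand (cong (λ m → 24 * m + c) (ℕ.≡ᵇ⇒≡ (c * e) n t))))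
      where
      open ℕ-Solver
      expand : c * (y * y) ≡ 24 * (c * e) + c
      expand = trans (cong (c *_) eq)
        (solve 2 (λ c e → c :* (con 24 :* e :+ con 1) := con 24 :* (c :* e) :+ c) refl c e)

    hit-∣ : ∀ {d} → d ∣ 24 → d ∤ c → ∀ n y → d ∣ y → hit c n y ≡ false
    hit-∣ {d} d∣24 d∤c n y d∣y = ¬T⇒false λ t → d∤c (∣m+n∣m⇒∣n
      (subst (d ∣_) (hit⁻ c n y t) (∣n⇒∣m*n c (∣m⇒∣m*n y d∣y))) (∣m⇒∣m*n n d∣24))

    -- Of the six values 6 n + 2, ..., 6 n + 7 only 6 j - 1 and 6 j + 1 with j = n + 1 are prime to
    -- 6, and their squares are 1 plus 24 times the two pentagonal numbers of j.
    ∑-hit-step : ∀ N n → ∑ (6 * suc n + 2) (hit c N) ≡ ∑ (6 * n + 2) (hit c N) xor coeff (pent n) N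
    ∑-hit-step N n = begin
      ∑ (6 * suc n + 2) h
        ≡⟨ cong (λ B → ∑ B h) (solve 1 (λ n → con 6 :* (con 1 :+ n) :+ con 2 := con 6 :+ (con 6 :* n :+ con 2)) refl n) ⟩
      ∑ (6 + B) h
        ≡⟨ ∑-sucʳ (5 + B) h ⟩
      ∑ (5 + B) h xor h (5 + B)
        ≡⟨ cong₂ _xor_ (∑-sucʳ (4 + B) h) (hit-pentagonal N (5 + B) (suc n * suc n + tri (suc n)) square₂) ⟩
      (∑ (4 + B) h xor h (4 + B)) xor r
        ≡⟨ cong (_xor r) (cong₂ _xor_ (∑-sucʳ (3 + B) h) (hit-∣ (divides 12 refl) 2∤c N (4 + B) (divides (3 * n + 3) ev₄))) ⟩
      ((∑ (3 + B) h xor h (3 + B)) xor false) xor r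
        ≡⟨ cong (_xor r) (𝔹.xor-identityʳ (∑ (3 + B) h xor h (3 + B))) ⟩
      (∑ (3 + B) h xor h (3 + B)) xor r
        ≡⟨ cong (_xor r) (cong₂ _xor_ (∑-sucʳ (2 + B) h) (hit-pentagonal N (3 + B) (suc n * n + tri (suc n)) square₁)) ⟩
      ((∑ (2 + B) h xor h (2 + B)) xor l) xor r
        ≡⟨ cong (λ z → (z xor l) xor r) (drop (2 + B) (hit-∣ (divides 12 refl) 2∤c N (2 + B) (divides (3 * n + 2) ev₂))) ⟩
      (∑ (2 + B) h xor l) xor r
        ≡⟨ cong (λ z → (z xor l) xor r) (trans (∑-sucʳ (1 + B) h) (drop (1 + B) (hit-∣ (divides 8 refl) 3∤c N (1 + B) (divides (2 * n + 1) th₁)))) ⟩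
      (∑ (1 + B) h xor l) xor r
        ≡⟨ cong (λ z → (z xor l) xor r) (trans (∑-sucʳ B h) (drop B (hit-∣ (divides 12 refl) 2∤c N B (divides (3 * n + 1) ev₀)))) ⟩
      (∑ B h xor l) xor r
        ≡⟨ 𝔹.xor-assoc (∑ B h) l r ⟩
      ∑ B h xor (l xor r) ∎
      where
      open ≡-Reasoning
      open ℕ-Solver
      h = hit c N
      B = 6 * n + 2
      l = coeff (x (suc n * n + tri (suc n))) N
      r = coeff (x (suc n * suc n + tri (suc n))) N
      drop : ∀ m → h m ≡ false → ∑ m h xor h m ≡ ∑ m h
      drop m eq = trans (cong (∑ m h xor_) eq) (𝔹.xor-identityʳ _)
      ev₀ : B ≡ (3 * n + 1) * 2
      ev₀ = solve 1 (λ n → con 6 :* n :+ con 2 := (con 3 :* n :+ con 1) :* con 2) refl n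
      th₁ : 1 + B ≡ (2 * n + 1) * 3
      th₁ = solve 1 (λ n → con 1 :+ (con 6 :* n :+ con 2) := (con 2 :* n :+ con 1) :* con 3) refl n
      ev₂ : 2 + B ≡ (3 * n + 2) * 2
      ev₂ = solve 1 (λ n → con 2 :+ (con 6 :* n :+ con 2) := (con 3 :* n :+ con 2) :* con 2) refl n
      ev₄ : 4 + B ≡ (3 * n + 3) * 2
      ev₄ = solve 1 (λ n → con 4 :+ (con 6 :* n :+ con 2) := (con 3 :* n :+ con 3) :* con 2) refl n
      24*_+tri : ∀ m → 24 * (m + tri (suc n)) + 1 ≡ 24 * m + 12 * (suc n * (2 + n)) + 1
      24* m +tri = trans (solve 2 (λ m t → con 24 :* (m :+ t) :+ con 1 := con 24 :* m :+ con 12 :* (con 2 :* t) :+ con 1) refl m (tri (suc n)))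
        (cong (λ z → 24 * m + 12 * z + 1) (2*tri (suc n)))
      square₁ : (3 + B) * (3 + B) ≡ 24 * (suc n * n + tri (suc n)) + 1
      square₁ = trans (solve 1 (λ n → (con 3 :+ (con 6 :* n :+ con 2)) :* (con 3 :+ (con 6 :* n :+ con 2))
        := con 24 :* ((con 1 :+ n) :* n) :+ con 12 :* ((con 1 :+ n) :* (con 2 :+ n)) :+ con 1) refl n) (sym (24* suc n * n +tri))
      square₂ : (5 + B) * (5 + B) ≡ 24 * (suc n * suc n + tri (suc n)) + 1
      square₂ = trans (solve 1 (λ n → (con 5 :+ (con 6 :* n :+ con 2)) :* (con 5 :+ (con 6 :* n :+ con 2))
        := con 24 :* ((con 1 :+ n) :* (con 1 :+ n)) :+ con 12 :* ((con 1 :+ n) :* (con 2 :+ n)) :+ con 1) refl n) (sym (24* suc n * suc n +tri))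

    terms-hit : ∀ n N → coeff (terms 0 n) N ≡ ∑ (6 * n + 2) (hit c N)
    terms-hit zero N = sym (begin
      hit c N 0 xor (hit c N 1 xor false)
        ≡⟨ cong₂ _xor_ (hit-∣ (divides 12 refl) 2∤c N 0 (divides 0 refl)) (𝔹.xor-identityʳ _) ⟩
      hit c N 1
        ≡⟨ hit-pentagonal N 1 0 refl ⟩
      coeff (x 0) N
        ≡⟨ at (⊛-identityˡ (x 0)) N ⟨
      coeff (terms 0 0) N ∎)
      where open ≡-Reasoning
    terms-hit (suc n) N = trans (at (shanks n) N)
      (trans (cong (_xor coeff (pent n) N) (terms-hit n N)) (sym (∑-hit-step N n)))

    Π≈θ : ∀ n → Π 0 n ≈[ suc (c * n) ] θ c
    Π≈θ n .at[] N (s≤s N≤) = trans (at[] (Π≈terms 1≤c n) N (s≤s N≤)) (trans (terms-hit n N) (T-ext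
      (λ t → let y , _ , h = ∑-true (6 * n + 2) t in θ⁺ {c} {N} y 1≤c (hit⁻ c N y h))
      (λ t → let y , eq = θ⁻ {c} {N} t in ∑-hit {c} {N} 1≤c (bound y eq) eq)))
      where
      -- Since (6 n + 2)² > 24 n + 1, a root y ≥ 6 n + 2 would have an index beyond c n.
      bound : ∀ y → c * (y * y) ≡ 24 * N + c → y < 6 * n + 2
      bound y eq = ℕ.≰⇒> λ le → ℕ.<⇒≱ (begin-strict
        c * (y * y)                    ≡⟨ eq ⟩
        24 * N + c                     ≤⟨ ℕ.+-monoˡ-≤ c (ℕ.*-monoʳ-≤ 24 N≤) ⟩
        24 * (c * n) + c               ≡⟨ solve 2 (λ c n → con 24 :* (c :* n) :+ c := c :* (con 24 :* n :+ con 1)) refl c n ⟩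
        c * (24 * n + 1)               <⟨ ℕ.*-monoʳ-< c {{>-nonZero 1≤c}} (ℕ.m≤m+n _ _) ⟩
        c * (suc (24 * n + 1) + (36 * (n * n) + 2))
          ≡⟨ cong (c *_) (solve 1 (λ n → con 1 :+ (con 24 :* n :+ con 1) :+ (con 36 :* (n :* n) :+ con 2)
               := (con 6 :* n :+ con 2) :* (con 6 :* n :+ con 2)) refl n) ⟩
        c * ((6 * n + 2) * (6 * n + 2)) ∎)
        (ℕ.*-monoʳ-≤ c (ℕ.*-mono-≤ le le))
        where
        open ℕ.≤-Reasoning
        open ℕ-Solver

-- Parity of the number of regular partitions

odd : ℕ → Bool
odd zero    = false
odd (suc n) = not (odd n)

even⇒2∣ : ∀ n → odd n ≡ false → 2 ∣ n
even⇒2∣ zero    _ = divides 0 refl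
even⇒2∣ (suc (suc n)) eq with divides q refl ← even⇒2∣ n (trans (sym (𝔹.not-involutive _)) eq) = divides (suc q) refl

parity : ∀ {A : Set} → (A → Bool) → List A → Bool
parity f []       = false
parity f (a ∷ as) = f a xor parity f as

module _ {A : Set} where

  parity-cong : ∀ {f g : A → Bool} → (∀ a → f a ≡ g a) → ∀ as → parity f as ≡ parity g as
  parity-cong eq []       = refl
  parity-cong eq (a ∷ as) = cong₂ _xor_ (eq a) (parity-cong eq as)

  parity-false : ∀ (as : List A) → parity (λ _ → false) as ≡ false
  parity-false []       = refl
  parity-false (_ ∷ as) = parity-false as

  parity-++ : ∀ (f : A → Bool) as bs → parity f (as ++ bs) ≡ parity f as xor parity f bs
  parity-++ f []       bs = refl
  parity-++ f (a ∷ as) bs = trans (cong (f a xor_) (parity-++ f as bs)) (sym (𝔹.xor-assoc (f a) _ _))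

  parity-map : ∀ {B : Set} (f : A → Bool) (h : B → A) bs → parity f (map h bs) ≡ parity (λ b → f (h b)) bs
  parity-map f h []       = refl
  parity-map f h (b ∷ bs) = cong (f (h b) xor_) (parity-map f h bs)

  parity-∧ˡ : ∀ r (f : A → Bool) as → parity (λ a → r ∧ f a) as ≡ r ∧ parity f as
  parity-∧ˡ false f as = parity-false as
  parity-∧ˡ true  f as = refl

  odd-length-filter² : ∀ {P Q : Pred A 0ℓ} (P? : Decidable P) (Q? : Decidable Q) as →
    odd (length (filter Q? (filter P? as))) ≡ parity (λ a → does (P? a) ∧ does (Q? a)) as
  odd-length-filter² P? Q? [] = refl
  odd-length-filter² P? Q? (a ∷ as) with does (P? a)
  ... | false = odd-length-filter² P? Q? as
  ... | true with does (Q? a)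
  ...   | false = odd-length-filter² P? Q? as
  ...   | true  = cong not (odd-length-filter² P? Q? as)

parity-shift : ∀ e (g : List ℕ → Bool) μs n →
  parity (λ μ → (e + sum μ ≡ᵇ n) ∧ g μ) μs ≡
  coeff (shift e (series λ n → parity (λ μ → (sum μ ≡ᵇ n) ∧ g μ) μs)) n
parity-shift zero    g μs n       = refl
parity-shift (suc e) g μs zero    = parity-false μs
parity-shift (suc e) g μs (suc n) = parity-shift e g μs n

module GeneratingFunction (ℓ : ℕ) where

  regular-part : ℕ → Bool
  regular-part i = not (does (ℓ ∣? i))

  regular : List ℕ → Bool
  regular μ = does (all? (λ part → ¬? (ℓ ∣? part)) μ)

  B : Series
  B .coeff n = odd (b ℓ n)

  boxS : ℕ → ℕ → Series
  boxS m k .coeff n = parity (λ μ → (sum μ ≡ᵇ n) ∧ regular μ) (box m k)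

  B-boxS : ∀ n → coeff B n ≡ coeff (boxS n n) n
  B-boxS n = odd-length-filter² (λ μ → sum μ ℕ.≟ n) (all? (λ part → ¬? (ℓ ∣? part))) (box n n)

  boxS-suc : ∀ m k → boxS (suc m) (suc k) ≈
             boxS m (suc k) ⊕ scale (regular-part (suc m)) (shift (suc m) (boxS (suc m) k))
  boxS-suc m k .at n = trans (parity-++ f (box m (suc k)) _) (cong (coeff (boxS m (suc k)) n xor_) (begin
    parity f (map (suc m ∷_) (box (suc m) k))
      ≡⟨ parity-map f (suc m ∷_) (box (suc m) k) ⟩
    parity (λ μ → (suc m + sum μ ≡ᵇ n) ∧ (r ∧ regular μ)) (box (suc m) k)
      ≡⟨ parity-cong (λ μ → ∧-swap (suc m + sum μ ≡ᵇ n) r (regular μ)) (box (suc m) k) ⟩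
    parity (λ μ → r ∧ ((suc m + sum μ ≡ᵇ n) ∧ regular μ)) (box (suc m) k)
      ≡⟨ parity-∧ˡ r _ (box (suc m) k) ⟩
    r ∧ parity (λ μ → (suc m + sum μ ≡ᵇ n) ∧ regular μ) (box (suc m) k)
      ≡⟨ cong (r ∧_) (trans (parity-shift (suc m) regular (box (suc m) k) n) (shift-≈ (suc m) n)) ⟩
    r ∧ coeff (shift (suc m) (boxS (suc m) k)) n ∎))
    where
    open ≡-Reasoning
    r = regular-part (suc m)
    f = λ μ → (sum μ ≡ᵇ n) ∧ regular μ
    shift-≈ : ∀ e n → coeff (shift e (series λ n → parity (λ μ → (sum μ ≡ᵇ n) ∧ regular μ) (box (suc m) k))) n
                    ≡ coeff (shift e (boxS (suc m) k)) n
    shift-≈ e n = at[] (shift-cong[] e {suc n} (below λ _ _ → refl)) n (ℕ.m≤n+m (suc n) e)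
    ∧-swap : ∀ a b c → a ∧ (b ∧ c) ≡ b ∧ (a ∧ c)
    ∧-swap = 𝔹-Solver.solve 3 (λ a b c → a 𝔹-Solver.:* (b 𝔹-Solver.:* c) 𝔹-Solver.:= b 𝔹-Solver.:* (a 𝔹-Solver.:* c)) refl

  regular-factor irregular-factor : ℕ → Series
  regular-factor   i = const true ⊕ scale (regular-part i) (mono i)
  irregular-factor i = const true ⊕ scale (not (regular-part i)) (mono i)

  ∏ : (ℕ → Series) → ℕ → Series
  ∏ f zero    = const true
  ∏ f (suc m) = f (suc m) ⊛ ∏ f m

  -- These split the product of 1 - q^i over i ≤ m into the factors with ℓ ∤ i and those with ℓ ∣ i.
  R A : ℕ → Series
  R = ∏ regular-factor
  A = ∏ irregular-factor

  R-0 : ∀ m → coeff (R m) 0 ≡ true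
  R-0 zero    = refl
  R-0 (suc m) = trans (𝔹.xor-identityʳ _) (cong₂ _∧_ (cong not (𝔹.∧-zeroʳ (regular-part (suc m)))) (R-0 m))

  scale≈const⊛ : ∀ a f → scale a f ≈ const a ⊛ f
  scale≈const⊛ a f = ≈-sym (const-⊛ a f)

  -- A partition of n ≤ k has at most k parts, so the bound on the number of parts is invisible
  -- below degree k + 1. In the induction, removing a part m + 1 costs one degree of accuracy,
  -- because one part fewer is allowed, and the factor q^(m + 1) restores at least that much.
  boxS-⊛-R : ∀ m k → boxS m k ⊛ R m ≈[ suc k ] const true
  boxS-⊛-R zero    k       = ≈⇒≈[] (≈-trans (⊛-identityʳ (boxS zero k)) (pointwise λ { zero → refl ; (suc n) → refl }))
  boxS-⊛-R (suc m) zero .at[] zero    _ = trans (𝔹.xor-identityʳ _) (R-0 (suc m))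
  boxS-⊛-R (suc m) zero .at[] (suc i) (s≤s ())
  boxS-⊛-R (suc m) (suc k) = begin
    boxS (suc m) (suc k) ⊛ (e ⊛ R m)
      ≈⟨ ≈⇒≈[] (⊛-cong (≈-trans (boxS-suc m k) (⊕-cong ≈-refl (scale≈const⊛ r _)))
           (⊛-cong (⊕-cong ≈-refl (scale≈const⊛ r _)) ≈-refl)) ⟩
    (g ⊕ const r ⊛ shift (suc m) h) ⊛ ((const true ⊕ const r ⊛ y) ⊛ R m)
      ≈⟨ ≈⇒≈[] (⊛-cong (⊕-cong ≈-refl (⊛-cong ≈-refl (≈-sym (mono-⊛ (suc m) h)))) ≈-refl) ⟩
    (g ⊕ const r ⊛ (y ⊛ h)) ⊛ ((const true ⊕ const r ⊛ y) ⊛ R m)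
      ≈⟨ ≈⇒≈[] (solve 5 (λ g r y h R → (g :+ r :* (y :* h)) :* ((con true :+ r :* y) :* R)
           := (con true :+ r :* y) :* (g :* R) :+ r :* (y :* (h :* ((con true :+ r :* y) :* R)))) ≈-refl g (const r) y h (R m)) ⟩
    (const true ⊕ const r ⊛ y) ⊛ (g ⊛ R m) ⊕ const r ⊛ (y ⊛ (h ⊛ ((const true ⊕ const r ⊛ y) ⊛ R m)))
      ≈⟨ ⊕-cong[] (⊛-cong[] ≈[]-refl (boxS-⊛-R m (suc k)))
           (⊛-cong[] ≈[]-refl mono-IH) ⟩
    (const true ⊕ const r ⊛ y) ⊛ const true ⊕ const r ⊛ (y ⊛ const true)
      ≈⟨ ≈⇒≈[] (solve 2 (λ r y → (con true :+ r :* y) :* con true :+ r :* (y :* con true) := con true) ≈-refl (const r) y) ⟩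
    const true ∎
    where
    open ≈[]-Reasoning (suc (suc k))
    open Series-Solver
    r = regular-part (suc m)
    e = regular-factor (suc m)
    y = mono (suc m)
    g = boxS m (suc k)
    h = boxS (suc m) k
    IH : h ⊛ ((const true ⊕ const r ⊛ y) ⊛ R m) ≈[ suc k ] const true
    IH = Setoid.trans (≈[]-setoid (suc k))
      (≈⇒≈[] (⊛-cong ≈-refl (⊛-cong (⊕-cong ≈-refl (const-⊛ r y)) ≈-refl))) (boxS-⊛-R (suc m) k)
    mono-IH : y ⊛ (h ⊛ ((const true ⊕ const r ⊛ y) ⊛ R m)) ≈[ suc (suc k) ] y ⊛ const true
    mono-IH = begin
      y ⊛ (h ⊛ ((const true ⊕ const r ⊛ y) ⊛ R m))            ≈⟨ ≈⇒≈[] (mono-⊛ (suc m) _) ⟩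
      shift (suc m) (h ⊛ ((const true ⊕ const r ⊛ y) ⊛ R m))  ≈⟨ ≈[]-mono (s≤s (ℕ.m≤n+m (suc k) m)) (shift-cong[] (suc m) IH) ⟩
      shift (suc m) (const true)                              ≈⟨ ≈⇒≈[] (mono-⊛ (suc m) _) ⟨
      y ⊛ const true                                          ∎

  R-stable : ∀ {n m} → n ≤ m → R m ≈[ suc n ] R n
  R-stable {n} {m} n≤m with d , refl ← ℕ.m≤n⇒∃[o]m+o≡n n≤m = go d
    where
    go : ∀ d → R (n + d) ≈[ suc n ] R n
    go zero    rewrite ℕ.+-identityʳ n = ≈[]-refl
    go (suc d) rewrite ℕ.+-suc n d = begin
      regular-factor (suc (n + d)) ⊛ R (n + d)
        ≈⟨ ⊛-cong[] (below λ i i≤n → trans (cong (coeff (const true) i xor_) (trans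
             (cong (regular-part (suc (n + d)) ∧_) (mono-below i≤n)) (𝔹.∧-zeroʳ _))) (𝔹.xor-identityʳ _)) (go d) ⟩
      const true ⊛ R n
        ≈⟨ ≈⇒≈[] (⊛-identityˡ (R n)) ⟩
      R n ∎
      where
      open ≈[]-Reasoning (suc n)
      mono-below : ∀ {i} → i < suc n → coeff (mono (suc (n + d))) i ≡ false
      mono-below {i} i≤n = ¬T⇒false λ t → ℕ.<⇒≢ (ℕ.<-≤-trans i≤n (s≤s (ℕ.m≤m+n n d))) (sym (ℕ.≡ᵇ⇒≡ (suc (n + d)) i t))

  -- Coefficient n of `B` comes from the box of side n, so boxes of different sides must be
  -- compared: those of sides n and m both invert `R n` below degree n + 1.
  B≈boxS : ∀ m → B ≈[ suc m ] boxS m m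
  B≈boxS m .at[] n (s≤s n≤m) = trans (B-boxS n) (at[] (inverse-unique[] (boxS-⊛-R n n) (begin
    boxS m m ⊛ R n  ≈⟨ ⊛-cong[] ≈[]-refl (R-stable n≤m) ⟨
    boxS m m ⊛ R m  ≈⟨ ≈[]-mono (s≤s n≤m) (boxS-⊛-R m m) ⟩
    const true      ∎)) n (ℕ.n<1+n n))
    where open ≈[]-Reasoning (suc n)

  open Pentagonal using (Π)

  R⊛A≈Π : ∀ m → R m ⊛ A m ≈ Π 1 0 m
  R⊛A≈Π zero    = ⊛-identityˡ (const true)
  R⊛A≈Π (suc m) = ≈-trans
    (solve 4 (λ r R a A → (r :* R) :* (a :* A) := (r :* a) :* (R :* A)) ≈-refl _ _ _ _)
    (⊛-cong (≈-trans (⊛-cong (⊕-cong ≈-refl (scale≈const⊛ r y)) (⊕-cong ≈-refl (scale≈const⊛ (not r) y))) (split r)) (R⊛A≈Π m))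
    where
    open Series-Solver
    r = regular-part (suc m)
    y = mono (suc m)
    split : ∀ r → (const true ⊕ const r ⊛ y) ⊛ (const true ⊕ const (not r) ⊛ y) ≈ Pentagonal.factor 1 (suc m)
    split r rewrite ℕ.+-identityʳ m with r
    ... | true  = solve 1 (λ y → (con true :+ con true :* y) :* (con true :+ con false :* y) := con true :+ y) ≈-refl y
    ... | false = solve 1 (λ y → (con true :+ con false :* y) :* (con true :+ con true :* y) := con true :+ y) ≈-refl y

  A-regular : ∀ {i} → ℓ ∤ i → irregular-factor i ≈ const true
  A-regular {i} ℓ∤i rewrite dec-false (ℓ ∣? i) ℓ∤i = pointwise λ n → 𝔹.xor-identityʳ _

  A-irregular : ∀ {i} → ℓ ∣ i → irregular-factor i ≈ const true ⊕ mono i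
  A-irregular {i} ℓ∣i rewrite dec-true (ℓ ∣? i) ℓ∣i = pointwise λ n → refl

  A-between : ∀ r s → s < ℓ → A (ℓ * r + s) ≈ A (ℓ * r)
  A-between r zero    _   rewrite ℕ.+-identityʳ (ℓ * r) = ≈-refl
  A-between r (suc s) s<ℓ rewrite ℕ.+-suc (ℓ * r) s = ≈-trans
    (⊛-cong (A-regular λ ℓ∣ → >⇒∤ s<ℓ (∣m+n∣m⇒∣n (subst (ℓ ∣_) (sym (ℕ.+-suc (ℓ * r) s)) ℓ∣) (m∣m*n r))) (A-between r s (ℕ.<⇒≤ s<ℓ)))
    (⊛-identityˡ _)

  A≈Π : 1 ≤ ℓ → ∀ r → A (ℓ * r) ≈ Π ℓ 0 r
  A≈Π 1≤ℓ zero    rewrite ℕ.*-zeroʳ ℓ = ≈-refl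
  A≈Π 1≤ℓ (suc r) with ℓ′ , refl ← ℕ.m≤n⇒∃[o]m+o≡n 1≤ℓ = begin
    A (suc ℓ′ * suc r)
      ≡⟨ cong A last ⟩
    irregular-factor (suc (suc ℓ′ * r + ℓ′)) ⊛ A (suc ℓ′ * r + ℓ′)
      ≈⟨ ⊛-cong (≈-trans (A-irregular (subst (suc ℓ′ ∣_) last (m∣m*n (suc r)))) (⊕-cong ≈-refl (pointwise λ n → cong (_≡ᵇ n) (sym last))))
           (≈-trans (A-between r ℓ′ ℕ.≤-refl) (A≈Π (s≤s z≤n) r)) ⟩
    Π (suc ℓ′) 0 (suc r) ∎
    where
    open ≈-Reasoning
    last : suc ℓ′ * suc r ≡ suc (suc ℓ′ * r + ℓ′)
    last = ℕ-Solver.solve 2 (λ l r → (ℕ-Solver.con 1 ℕ-Solver.:+ l) ℕ-Solver.:* (ℕ-Solver.con 1 ℕ-Solver.:+ r)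
      ℕ-Solver.:= ℕ-Solver.con 1 ℕ-Solver.:+ ((ℕ-Solver.con 1 ℕ-Solver.:+ l) ℕ-Solver.:* r ℕ-Solver.:+ l)) refl ℓ′ r

  B⊛θ₁≈θ : 2 ∤ ℓ → 3 ∤ ℓ → B ⊛ θ 1 ≈ θ ℓ
  B⊛θ₁≈θ 2∤ℓ 3∤ℓ .at n = at[] equal n (s≤s (ℕ.m≤n*m n ℓ {{>-nonZero 1≤ℓ}}))
    where
    1≤ℓ = Pentagonal.1≤c ℓ 2∤ℓ 3∤ℓ
    -- Truncating at a multiple of ℓ turns `A m` into exactly `Π ℓ 0 n`, and agreement up to degree
    -- ℓ n covers coefficient n.
    m = ℓ * n
    open ≈[]-Reasoning (suc m)
    equal : B ⊛ θ 1 ≈[ suc m ] θ ℓ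
    equal = begin
      B ⊛ θ 1                   ≈⟨ ⊛-cong[] (Setoid.sym (≈[]-setoid (suc m)) (B≈boxS m)) (subst (λ k → Π 1 0 m ≈[ suc k ] θ 1) (ℕ.*-identityˡ m)
                                     (Pentagonal.Π≈θ 1 (from-no (2 ∣? 1)) (from-no (3 ∣? 1)) m)) ⟨
      boxS m m ⊛ Π 1 0 m        ≈⟨ ≈⇒≈[] (⊛-cong ≈-refl (≈-sym (R⊛A≈Π m))) ⟩
      boxS m m ⊛ (R m ⊛ A m)    ≈⟨ ≈⇒≈[] (≈-sym (⊛-assoc (boxS m m) (R m) (A m))) ⟩
      (boxS m m ⊛ R m) ⊛ A m    ≈⟨ ⊛-cong[] (boxS-⊛-R m m) ≈[]-refl ⟩
      const true ⊛ A m          ≈⟨ ≈⇒≈[] (≈-trans (⊛-identityˡ (A m)) (A≈Π 1≤ℓ n)) ⟩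
      Π ℓ 0 n                   ≈⟨ Pentagonal.Π≈θ ℓ 2∤ℓ 3∤ℓ n ⟩
      θ ℓ                       ∎

-- Products of theta series

-- The matrix of _~_ restricted to χ is symmetric with row sums χ.
∑-involution : ∀ n (χ d : ℕ → Bool) (_~_ : ℕ → ℕ → Set) →
  (∀ {i j} → i ~ j → j ~ i) →
  (∀ {i j k} → i ~ j → i ~ k → j ≡ k) →
  (∀ {i} → i < n → T (χ i) → ∃ λ j → j < n × T (χ j) × i ~ j) →
  (∀ {i} → T (χ i) → (i ~ i) ⇔ T (d i)) →
  ∑ n χ ≡ ∑ n (λ i → χ i ∧ d i)
∑-involution n χ d _~_ ~-sym ~-functional partner fixed = begin
  ∑ n χ                      ≡⟨ ∑-cong n (λ i i<n → T-ext (row⁺ i<n) (λ t → let _ , _ , aij = ∑-true n t in proj₁ (proj₂ (a⁻ aij)))) ⟩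
  ∑ n (λ i → ∑ n (a i))      ≡⟨ ∑∑-symmetric n a (λ i j → T-ext a-sym a-sym) ⟩
  ∑ n (λ i → a i i)          ≡⟨ ∑-cong n (λ i i<n → T-ext diagonal⁻ (diagonal⁺ i<n)) ⟩
  ∑ n (λ i → χ i ∧ d i)      ∎
  where
  open ≡-Reasoning
  -- `_~_` is not assumed decidable, so an entry compares j with the partner chosen for i.
  -- Functionality makes the choice immaterial.
  a : ℕ → ℕ → Bool
  a i j with i ℕ.<? n | T? (χ i)
  ... | yes i<n | yes χi = j ≡ᵇ proj₁ (partner i<n χi)
  ... | _       | _      = false
  a⁺ : ∀ {i j} → i < n → T (χ i) → i ~ j → T (a i j)
  a⁺ {i} {j} i<n χi i~j with i ℕ.<? n | T? (χ i)
  ... | yes i<n′ | yes χi′ = let k , _ , _ , i~k = partner i<n′ χi′ in ℕ.≡⇒≡ᵇ j k (~-functional i~j i~k)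
  ... | no i≮n   | _       = i≮n i<n
  ... | yes _    | no ¬χi  = ¬χi χi
  a⁻ : ∀ {i j} → T (a i j) → i < n × T (χ i) × j < n × T (χ j) × i ~ j
  a⁻ {i} {j} t with i ℕ.<? n | T? (χ i)
  ... | yes i<n | yes χi with k , k<n , χk , i~k ← partner i<n χi with refl ← ℕ.≡ᵇ⇒≡ j k t =
    i<n , χi , k<n , χk , i~k
  a-sym : ∀ {i j} → T (a i j) → T (a j i)
  a-sym t = let _ , _ , j<n , χj , i~j = a⁻ t in a⁺ j<n χj (~-sym i~j)
  row⁺ : ∀ {i} → i < n → T (χ i) → T (∑ n (a i))
  row⁺ {i} i<n χi with k , k<n , _ , i~k ← partner i<n χi = Equivalence.from 𝔹.T-≡
    (∑-unique n k<n (a⁺ i<n χi i~k) λ j _ aij →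
      let _ , _ , _ , _ , i~j = a⁻ aij in ~-functional i~j i~k)
  diagonal⁻ : ∀ {i} → T (a i i) → T (χ i ∧ d i)
  diagonal⁻ {i} t = let _ , χi , _ , _ , i~i = a⁻ {i} {i} t in Equivalence.from 𝔹.T-∧ (χi , Equivalence.to (fixed χi) i~i)
  diagonal⁺ : ∀ {i} → i < n → T (χ i ∧ d i) → T (a i i)
  diagonal⁺ i<n t = let χi , di = Equivalence.to 𝔹.T-∧ t in a⁺ i<n χi (Equivalence.from (fixed χi) di)

-- Equations over the integers and squares modulo 24.

-- The ring solver proves only unconditional identities. A consequence of hypotheses is reduced to
-- one by writing a - b as a combination of the differences of their sides; the cofactor k is the
-- certificate, checked by a `ring` lemma at each use.
linear₁ : ∀ {a b p q} k → a ℤ.- b ≡ k ℤ.* (p ℤ.- q) → p ≡ q → a ≡ b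
linear₁ {a} {b} {p} k eq refl = ℤ.i-j≡0⇒i≡j a b (trans eq (trans (cong (k ℤ.*_) (ℤ.+-inverseʳ p)) (ℤ.*-zeroʳ k)))

linear₂ : ∀ {a b p q p′ q′} k k′ → a ℤ.- b ≡ k ℤ.* (p ℤ.- q) ℤ.+ k′ ℤ.* (p′ ℤ.- q′) → p ≡ q → p′ ≡ q′ → a ≡ b
linear₂ {a} {b} {p} {_} {p′} k k′ eq refl refl = ℤ.i-j≡0⇒i≡j a b (trans eq (cong₂ ℤ._+_ (zeros k p) (zeros k′ p′)))
  where
  zeros : ∀ k p → k ℤ.* (p ℤ.- p) ≡ 0ℤ
  zeros k p = trans (cong (k ℤ.*_) (ℤ.+-inverseʳ p)) (ℤ.*-zeroʳ k)

squares-equal : ∀ x y → x ℤ.* x ≡ y ℤ.* y → x ≡ y ⊎ x ≡ ℤ.- y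
squares-equal x y eq with ℤ.i*j≡0⇒i≡0∨j≡0 (x ℤ.- y) (linear₁ {b = 0ℤ} (+ 1) (ring x y) eq)
  where
  ring : ∀ x y → (x ℤ.- y) ℤ.* (x ℤ.+ y) ℤ.- 0ℤ ≡ + 1 ℤ.* (x ℤ.* x ℤ.- y ℤ.* y)
  ring = ℤ-Solver.solve-∀
... | inj₁ x-y≡0 = inj₁ (ℤ.i-j≡0⇒i≡j x y x-y≡0)
... | inj₂ x+y≡0 = inj₂ (ℤ.i-j≡0⇒i≡j x (ℤ.- y) (trans (cong (λ w → x ℤ.+ w) (ℤ.neg-involutive y)) x+y≡0))

square-abs : ∀ z → + (ℤ.∣ z ∣ * ℤ.∣ z ∣) ≡ z ℤ.* z
square-abs (+ n)    = ℤ.pos-* n n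
square-abs -[1+ n ] = refl

even-or-odd : ∀ z → ∃ λ e → z ≡ + 2 ℤ.* e ⊎ z ≡ + 2 ℤ.* e ℤ.+ + 1
even-or-odd z with z %ℕ 2 in r≡ | n%ℕd<d z 2
... | 0 | _ = z /ℕ 2 , inj₁ (trans (a≡a%ℕn+[a/ℕn]*n z 2) (trans (cong (λ r → + r ℤ.+ z /ℕ 2 ℤ.* + 2) r≡) (ring (z /ℕ 2))))
  where
  ring : ∀ q → + 0 ℤ.+ q ℤ.* + 2 ≡ + 2 ℤ.* q
  ring = ℤ-Solver.solve-∀
... | 1 | _ = z /ℕ 2 , inj₂ (trans (a≡a%ℕn+[a/ℕn]*n z 2) (trans (cong (λ r → + r ℤ.+ z /ℕ 2 ℤ.* + 2) r≡) (ring (z /ℕ 2))))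
  where
  ring : ∀ q → + 1 ℤ.+ q ℤ.* + 2 ≡ + 2 ℤ.* q ℤ.+ + 1
  ring = ℤ-Solver.solve-∀
... | suc (suc _) | s≤s (s≤s ())

no-multiple : ∀ {d a r} → d ℤ∣.∣ a → ¬ (d ℤ∣.∣ r) → ∀ k m → d ℤ.* k ≢ a ℤ.* m ℤ.+ r
no-multiple d∣a d∤r k m eq =
  d∤r (ℤ∣.∣m+n∣m⇒∣n (subst (_ ℤ∣.∣_) eq (ℤ∣.∣m⇒∣m*n k ℤ∣.∣-refl)) (ℤ∣.∣m⇒∣m*n m d∣a))

dk≢r : ∀ {d r} → ¬ (d ℤ∣.∣ r) → ∀ k → d ℤ.* k ≢ r
dk≢r {d} d∤r k eq = d∤r (ℤ∣.divides k (trans (sym eq) (ℤ.*-comm d k)))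

2k≢6m+1 : ∀ k m → + 2 ℤ.* k ≢ + 6 ℤ.* m ℤ.+ + 1
2k≢6m+1 = no-multiple (from-yes (+ 2 ℤ∣.∣? + 6)) (from-no (+ 2 ℤ∣.∣? + 1))

Residue-24 : ℕ → Set
Residue-24 r = 2 ∣ r ⊎ 3 ∣ r ⊎ (r * r) % 24 ≡ 1

residues-mod-24 : ∀ {r} → r < 24 → Residue-24 r
residues-mod-24 r<24 = subst Residue-24 (Fin.toℕ-fromℕ< r<24) (all-residues (fromℕ< r<24))
  where
  all-residues : ∀ i → Residue-24 (toℕ i)
  all-residues = from-yes (Fin.all? {n = 24} λ i → 2 ∣? toℕ i ⊎-dec 3 ∣? toℕ i ⊎-dec (toℕ i * toℕ i) % 24 ℕ.≟ 1)

square-of-residue : ∀ {n r q d} → n ≡ r + q * 24 → r * r ≡ 1 + d * 24 → ∃ λ e → n * n ≡ 24 * e + 1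
square-of-residue {n} {r} {q} {d} n≡ r²≡ = d + z , (begin
  n * n                        ≡⟨ cong₂ _*_ n≡ n≡ ⟩
  (r + q * 24) * (r + q * 24)  ≡⟨ solve 2 (λ r q → (r :+ q :* con 24) :* (r :+ q :* con 24)
                                    := r :* r :+ con 24 :* (con 2 :* r :* q :+ con 24 :* q :* q)) refl r q ⟩
  r * r + 24 * z               ≡⟨ cong (λ r² → r² + 24 * z) r²≡ ⟩
  1 + d * 24 + 24 * z          ≡⟨ solve 2 (λ d z → con 1 :+ d :* con 24 :+ con 24 :* z := con 24 :* (d :+ z) :+ con 1) refl d z ⟩
  24 * (d + z) + 1             ∎)
  where
  open ≡-Reasoning
  open ℕ-Solver
  z = 2 * r * q + 24 * q * q

%≡1⇒≡1+ : ∀ m → m % 24 ≡ 1 → ∃ λ d → m ≡ 1 + d * 24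
%≡1⇒≡1+ m eq = m / 24 , trans (m≡m%n+[m/n]*n m 24) (cong (_+ m / 24 * 24) eq)

square-mod-24′ : ∀ n r q → n ≡ r + q * 24 → Residue-24 r → 2 ∤ n → 3 ∤ n → ∃ λ e → n * n ≡ 24 * e + 1
square-mod-24′ n r q n≡ (inj₁ 2∣r)        2∤n 3∤n = contradiction (subst (2 ∣_) (sym n≡) (∣m∣n⇒∣m+n 2∣r (∣n⇒∣m*n q (divides 12 refl)))) 2∤n
square-mod-24′ n r q n≡ (inj₂ (inj₁ 3∣r)) 2∤n 3∤n = contradiction (subst (3 ∣_) (sym n≡) (∣m∣n⇒∣m+n 3∣r (∣n⇒∣m*n q (divides 8 refl)))) 3∤n
square-mod-24′ n r q n≡ (inj₂ (inj₂ r²))  2∤n 3∤n = let d , r²≡ = %≡1⇒≡1+ (r * r) r² in square-of-residue {n} {r} {q} {d} n≡ r²≡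

square-mod-24 : ∀ n → 2 ∤ n → 3 ∤ n → ∃ λ e → n * n ≡ 24 * e + 1
square-mod-24 n = square-mod-24′ n (n % 24) (n / 24) (m≡m%n+[m/n]*n n 24) (residues-mod-24 (m%n<n n 24))

∤-factor : ∀ {d} → + d ℤ∣.∣ + 6 → ¬ (+ d ℤ∣.∣ + 1) → ∀ z w m → z ℤ.* w ≡ + 6 ℤ.* m ℤ.+ + 1 → d ∤ ℤ.∣ z ∣
∤-factor {d} d∣6 d∤1 z w m eq d∣z with ℤ∣.divides q refl ← ℤ∣.∣ᵤ⇒∣ {+ d} {z} d∣z =
  no-multiple d∣6 d∤1 (q ℤ.* w) m (trans (ring (+ d) q w) eq)
  where
  ring : ∀ d q w → d ℤ.* (q ℤ.* w) ≡ q ℤ.* d ℤ.* w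
  ring = ℤ-Solver.solve-∀

abs-square-mod-24 : ∀ z → (∃ λ e → ℤ.∣ z ∣ * ℤ.∣ z ∣ ≡ 24 * e + 1) → ∃ λ e → z ℤ.* z ≡ + 24 ℤ.* + e ℤ.+ + 1
abs-square-mod-24 z (e , eq) = e , trans (sym (square-abs z)) (trans (cong +_ eq) (cong (ℤ._+ + 1) (ℤ.pos-* 24 e)))

-- A divisor of a number 6 m + 1 is prime to 2 and 3. Applied to x x′ = 6 (n - 2 b²) + 1, this gives
-- the conjugate x′ an integral index.
divisor-square-mod-24 : ∀ z w m → z ℤ.* w ≡ + 6 ℤ.* m ℤ.+ + 1 → ∃ λ e → z ℤ.* z ≡ + 24 ℤ.* + e ℤ.+ + 1
divisor-square-mod-24 z w m eq = abs-square-mod-24 z (square-mod-24 ℤ.∣ z ∣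
  (∤-factor {2} (from-yes (+ 2 ℤ∣.∣? + 6)) (from-no (+ 2 ℤ∣.∣? + 1)) z w m eq)
  (∤-factor {3} (from-yes (+ 3 ℤ∣.∣? + 6)) (from-no (+ 3 ℤ∣.∣? + 1)) z w m eq))

-- The integer version of `hit`, which leaves the signs of x and of the index free, so that
-- conjugation and subtraction of indices need no side conditions.
Root : ℤ → ℤ → ℤ → Set
Root c u x = c ℤ.* (x ℤ.* x) ≡ + 24 ℤ.* u ℤ.+ c

root⁺ : ∀ {c u x} → c * (x * x) ≡ 24 * u + c → Root (+ c) (+ u) (+ x)
root⁺ {c} {u} {x} eq = trans (cong (+ c ℤ.*_) (sym (ℤ.pos-* x x))) (trans (sym (ℤ.pos-* c (x * x)))
  (trans (cong +_ eq) (cong (ℤ._+ + c) (ℤ.pos-* 24 u))))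

root⁻ : ∀ {c u} x → Root (+ c) (+ u) x → c * (ℤ.∣ x ∣ * ℤ.∣ x ∣) ≡ 24 * u + c
root⁻ {c} {u} x eq = ℤ.+-injective (trans (ℤ.pos-* c _) (trans (cong (+ c ℤ.*_) (square-abs x))
  (trans eq (cong (ℤ._+ + c) (sym (ℤ.pos-* 24 u))))))

-- 24 z + 3 is three times a square. Applied to the index k - u′ of the conjugate of y, this yields
-- u′ ≤ k.
root₃-nonneg : ∀ z y → Root (+ 3) z y → 0ℤ ℤ.≤ z
root₃-nonneg (+ _)    _ _  = ℤ.+≤+ z≤n
root₃-nonneg -[1+ m ] y eq = contradiction
  (trans (ℤ.pos-* 3 (ℤ.∣ y ∣ * ℤ.∣ y ∣)) (trans (cong (+ 3 ℤ.*_) (square-abs y)) (trans eq (trans (ring (+ m))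
    (cong (λ q → ℤ.- (+ 21 ℤ.+ q)) (sym (ℤ.pos-* 24 m)))))))
  (pos≢neg (3 * (ℤ.∣ y ∣ * ℤ.∣ y ∣)) (20 + 24 * m))
  where
  pos≢neg : ∀ i j → + i ≢ -[1+ j ]
  pos≢neg i j ()
  ring : ∀ m → + 24 ℤ.* (ℤ.- (+ 1 ℤ.+ m)) ℤ.+ + 3 ≡ ℤ.- (+ 21 ℤ.+ + 24 ℤ.* m)
  ring = ℤ-Solver.solve-∀

odd-root : ∀ u x h → Root (+ 2 ℤ.* h ℤ.+ + 1) u x → ∃ λ X → x ≡ + 2 ℤ.* X ℤ.+ + 1
odd-root u x h eq with even-or-odd x
... | X , inj₂ x≡  = X , x≡
... | X , inj₁ refl = contradiction (linear₁ (+ 1) (ring h u X) eq)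
  (dk≢r (from-no (+ 2 ℤ∣.∣? + 1)) ((+ 2 ℤ.* h ℤ.+ + 1) ℤ.* (+ 2 ℤ.* (X ℤ.* X)) ℤ.- + 12 ℤ.* u ℤ.- h))
  where
  ring : ∀ h u X → + 2 ℤ.* ((+ 2 ℤ.* h ℤ.+ + 1) ℤ.* (+ 2 ℤ.* (X ℤ.* X)) ℤ.- + 12 ℤ.* u ℤ.- h) ℤ.- + 1
    ≡ + 1 ℤ.* ((+ 2 ℤ.* h ℤ.+ + 1) ℤ.* (+ 2 ℤ.* X ℤ.* (+ 2 ℤ.* X)) ℤ.- (+ 24 ℤ.* u ℤ.+ (+ 2 ℤ.* h ℤ.+ + 1)))
  ring = ℤ-Solver.solve-∀

-- With y = x - 4 s b the form c x² + 3 y² becomes 4 s² (x x′ + 12 b²), where x′ = x - 3 t b. Exchanging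
-- x and x′ (and negating b) is an involution on its representations of 4 s² (6 n + 1), with fixed point b = 0.
module Conjugation
  (s t h : ℤ) (c k n : ℕ)
  (c-odd : + c ≡ + 2 ℤ.* h ℤ.+ + 1)
  (st : s ℤ.* t ≡ + 2) (c+3 : + c ℤ.+ + 3 ≡ + 4 ℤ.* (s ℤ.* s))
  -- `k-size` means k = s² n. The conclusion of `split`, read with x = 2 X + 1 and y = 2 Y + 1, is
  -- that 4 s divides x - y or x + y.
  (k-size : 4 * k ≡ (c + 3) * n)
  (split : ∀ X Y W → + 3 ℤ.* (X ℤ.- Y) ℤ.* (X ℤ.+ Y ℤ.+ + 1) ≡ s ℤ.* s ℤ.* W →
           ∃ λ b → X ℤ.- Y ≡ + 2 ℤ.* s ℤ.* b ⊎ X ℤ.+ Y ℤ.+ + 1 ≡ + 2 ℤ.* s ℤ.* b)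
  where

  private
    C N : ℤ
    C = + c
    N = + n

  size : + 24 ℤ.* + k ℤ.+ (C ℤ.+ + 3) ≡ + 4 ℤ.* (s ℤ.* s) ℤ.* (+ 6 ℤ.* N ℤ.+ + 1)
  size = linear₂ (+ 6) (+ 6 ℤ.* N ℤ.+ + 1) (ring (+ k) C N (+ 4 ℤ.* (s ℤ.* s)))
    (trans (sym (ℤ.pos-* 4 k)) (trans (cong +_ k-size) (ℤ.pos-* (c + 3) n))) c+3
    where
    ring : ∀ k c n w → + 24 ℤ.* k ℤ.+ (c ℤ.+ + 3) ℤ.- w ℤ.* (+ 6 ℤ.* n ℤ.+ + 1) ≡
      + 6 ℤ.* (+ 4 ℤ.* k ℤ.- (c ℤ.+ + 3) ℤ.* n) ℤ.+ (+ 6 ℤ.* n ℤ.+ + 1) ℤ.* (c ℤ.+ + 3 ℤ.- w)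
    ring = ℤ-Solver.solve-∀

  s≢0 : s ≢ 0ℤ
  s≢0 s≡0 with () ← trans (sym st) (cong (ℤ._* t) s≡0)

  t≢0 : t ≢ 0ℤ
  t≢0 t≡0 with () ← trans (sym st) (trans (cong (s ℤ.*_) t≡0) (ℤ.*-zeroʳ s))

  C≢0 : C ≢ 0ℤ
  C≢0 C≡0 = dk≢r (from-no (+ 2 ℤ∣.∣? + 1)) (ℤ.- h) (linear₁ (+ 1) (ring h) (trans (sym C≡0) c-odd))
    where
    ring : ∀ h → + 2 ℤ.* (ℤ.- h) ℤ.- + 1 ≡ + 1 ℤ.* (0ℤ ℤ.- (+ 2 ℤ.* h ℤ.+ + 1))
    ring = ℤ-Solver.solve-∀

  form-identity : ∀ x b → let y = x ℤ.- + 4 ℤ.* s ℤ.* b in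
    C ℤ.* (x ℤ.* x) ℤ.+ + 3 ℤ.* (y ℤ.* y) ≡
    + 4 ℤ.* (s ℤ.* s) ℤ.* (x ℤ.* (x ℤ.- + 3 ℤ.* t ℤ.* b) ℤ.+ + 12 ℤ.* (b ℤ.* b))
  form-identity x b = linear₂ (x ℤ.* x) (+ 12 ℤ.* s ℤ.* x ℤ.* b) (ring C s t x b) c+3 st
    where
    ring : ∀ c s t x b → let y = x ℤ.- + 4 ℤ.* s ℤ.* b in
      c ℤ.* (x ℤ.* x) ℤ.+ + 3 ℤ.* (y ℤ.* y) ℤ.-
      + 4 ℤ.* (s ℤ.* s) ℤ.* (x ℤ.* (x ℤ.- + 3 ℤ.* t ℤ.* b) ℤ.+ + 12 ℤ.* (b ℤ.* b)) ≡
      x ℤ.* x ℤ.* (c ℤ.+ + 3 ℤ.- + 4 ℤ.* (s ℤ.* s)) ℤ.+ + 12 ℤ.* s ℤ.* x ℤ.* b ℤ.* (s ℤ.* t ℤ.- + 2)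
    ring = ℤ-Solver.solve-∀

  -- Two indices are related through any choice of signed roots; y is not stored, being x - 4 s β.
  record Conjugate (u u′ : ℕ) : Set where
    constructor conjugate
    field
      x x′ β : ℤ
      step   : x′ ≡ x ℤ.- + 3 ℤ.* t ℤ.* β
      root   : Root C (+ u) x
      root′  : Root C (+ u′) x′
      form   : x ℤ.* x′ ℤ.+ + 12 ℤ.* (β ℤ.* β) ≡ + 6 ℤ.* N ℤ.+ + 1

  Conjugate-sym : ∀ {u u′} → Conjugate u u′ → Conjugate u′ u
  Conjugate-sym (conjugate x _ b refl root root′ form) =
    conjugate (x ℤ.- + 3 ℤ.* t ℤ.* b) x (ℤ.- b) (ring₁ x t b) root′ root (trans (ring₂ x t b) form)
    where
    ring₁ : ∀ x t b → x ≡ x ℤ.- + 3 ℤ.* t ℤ.* b ℤ.- + 3 ℤ.* t ℤ.* (ℤ.- b)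
    ring₁ = ℤ-Solver.solve-∀
    ring₂ : ∀ x t b → (x ℤ.- + 3 ℤ.* t ℤ.* b) ℤ.* x ℤ.+ + 12 ℤ.* ((ℤ.- b) ℤ.* (ℤ.- b))
                    ≡ x ℤ.* (x ℤ.- + 3 ℤ.* t ℤ.* b) ℤ.+ + 12 ℤ.* (b ℤ.* b)
    ring₂ = ℤ-Solver.solve-∀

  root-unique : ∀ u x y → Root C u x → Root C u y → x ≡ y ⊎ x ≡ ℤ.- y
  root-unique u x y rx ry = squares-equal x y
    (ℤ.*-cancelˡ-≡ C (x ℤ.* x) (y ℤ.* y) {{ℤ.≢-nonZero C≢0}} (trans rx (sym ry)))

  index-unique : ∀ u u′ x → Root C (+ u) x → Root C (+ u′) x → u ≡ u′
  index-unique u u′ x r r′ = ℤ.+-injective (ℤ.*-cancelˡ-≡ (+ 24) (+ u) (+ u′)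
    (linear₁ (+ 1) (ring (+ u) (+ u′) C) (trans (sym r) r′)))
    where
    ring : ∀ u v c → + 24 ℤ.* u ℤ.- + 24 ℤ.* v ≡ + 1 ℤ.* (+ 24 ℤ.* u ℤ.+ c ℤ.- (+ 24 ℤ.* v ℤ.+ c))
    ring = ℤ-Solver.solve-∀

  -- The other root of the form, viewed as a quadratic in b, is not an integer since x is odd.
  form-unique : ∀ x b d → let f = λ b → x ℤ.* (x ℤ.- + 3 ℤ.* t ℤ.* b) ℤ.+ + 12 ℤ.* (b ℤ.* b) in
    f b ≡ + 6 ℤ.* N ℤ.+ + 1 → f d ≡ + 6 ℤ.* N ℤ.+ + 1 → b ≡ d
  form-unique x b d fb fd
    with ℤ.i*j≡0⇒i≡0∨j≡0 (b ℤ.- d) (linear₁ {b = 0ℤ} (+ 1) (ring x t b d) (trans fb (sym fd)))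
    where
    ring : ∀ x t b d → (b ℤ.- d) ℤ.* (+ 12 ℤ.* (b ℤ.+ d) ℤ.- + 3 ℤ.* t ℤ.* x) ℤ.- 0ℤ ≡
      + 1 ℤ.* (x ℤ.* (x ℤ.- + 3 ℤ.* t ℤ.* b) ℤ.+ + 12 ℤ.* (b ℤ.* b) ℤ.- (x ℤ.* (x ℤ.- + 3 ℤ.* t ℤ.* d) ℤ.+ + 12 ℤ.* (d ℤ.* d)))
    ring = ℤ-Solver.solve-∀
  ... | inj₁ b-d≡0 = ℤ.i-j≡0⇒i≡j b d b-d≡0
  ... | inj₂ eq = contradiction (trans (ring₂ s (b ℤ.+ d) x′ (b ℤ.* b)) (trans (cong (λ x → x ℤ.* x′ ℤ.+ + 12 ℤ.* (b ℤ.* b)) (sym x≡)) fb))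
                    (2k≢6m+1 _ N)
    where
    x′ = x ℤ.- + 3 ℤ.* t ℤ.* b
    ring₁ : ∀ s t e x → + 6 ℤ.* x ℤ.- + 6 ℤ.* (+ 2 ℤ.* s ℤ.* e) ≡
      (ℤ.- s) ℤ.* (+ 12 ℤ.* e ℤ.- + 3 ℤ.* t ℤ.* x ℤ.- 0ℤ) ℤ.+ (ℤ.- (+ 3 ℤ.* x)) ℤ.* (s ℤ.* t ℤ.- + 2)
    ring₁ = ℤ-Solver.solve-∀
    x≡ : x ≡ + 2 ℤ.* s ℤ.* (b ℤ.+ d)
    x≡ = ℤ.*-cancelˡ-≡ (+ 6) x _ (linear₂ (ℤ.- s) (ℤ.- (+ 3 ℤ.* x)) (ring₁ s t (b ℤ.+ d) x) eq st)
    ring₂ : ∀ s e x′ q → + 2 ℤ.* (s ℤ.* e ℤ.* x′ ℤ.+ + 6 ℤ.* q) ≡ + 2 ℤ.* s ℤ.* e ℤ.* x′ ℤ.+ + 12 ℤ.* q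
    ring₂ = ℤ-Solver.solve-∀

  same-index : ∀ u v x {b d} → b ≡ d →
    Root C (+ u) (x ℤ.- + 3 ℤ.* t ℤ.* b) → Root C (+ v) (x ℤ.- + 3 ℤ.* t ℤ.* d) → u ≡ v
  same-index u v x {b} refl = index-unique u v (x ℤ.- + 3 ℤ.* t ℤ.* b)

  -- Roots of the same index agree up to sign, and x determines b. Negating both x and b negates x′
  -- and leaves its index unchanged.
  Conjugate-functional : ∀ {u v w} → Conjugate u v → Conjugate u w → v ≡ w
  Conjugate-functional {u} {v} {w} (conjugate x _ b refl rx rx′ fx) (conjugate y _ d refl ry ry′ fy)
    with root-unique (+ u) x y rx ry
  ... | inj₁ refl = same-index v w x (form-unique x b d fx fy) rx′ ry′
  ... | inj₂ refl = same-index v w y (form-unique y (ℤ.- b) d (trans (ring y t b) fx) fy)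
                      (trans (cong (C ℤ.*_) (ring₂ y t b)) rx′) ry′
    where
    ring : ∀ y t b → y ℤ.* (y ℤ.- + 3 ℤ.* t ℤ.* (ℤ.- b)) ℤ.+ + 12 ℤ.* ((ℤ.- b) ℤ.* (ℤ.- b))
                   ≡ (ℤ.- y) ℤ.* (ℤ.- y ℤ.- + 3 ℤ.* t ℤ.* b) ℤ.+ + 12 ℤ.* (b ℤ.* b)
    ring = ℤ-Solver.solve-∀
    ring₂ : ∀ y t b → (y ℤ.- + 3 ℤ.* t ℤ.* (ℤ.- b)) ℤ.* (y ℤ.- + 3 ℤ.* t ℤ.* (ℤ.- b))
                    ≡ (ℤ.- y ℤ.- + 3 ℤ.* t ℤ.* b) ℤ.* (ℤ.- y ℤ.- + 3 ℤ.* t ℤ.* b)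
    ring₂ = ℤ-Solver.solve-∀

  -- If x′ = x, then b = 0 and x² = 6 n + 1. If x′ = -x, then 2 x = 3 t b, and four times the form
  -- is divisible by 3 while 4 (6 n + 1) is not.
  Conjugate-fixed⁻ : ∀ {u} → Conjugate u u → 4 * u ≡ c * n
  Conjugate-fixed⁻ {u} (conjugate x _ b refl rx rx′ f) with root-unique (+ u) x (x ℤ.- + 3 ℤ.* t ℤ.* b) rx rx′
  ... | inj₁ x≡x′ with ℤ.i*j≡0⇒i≡0∨j≡0 t (ℤ.*-cancelˡ-≡ (+ 3) (t ℤ.* b) 0ℤ (linear₁ (+ 1) (ring x t b) x≡x′))
    where
    ring : ∀ x t b → + 3 ℤ.* (t ℤ.* b) ℤ.- + 3 ℤ.* 0ℤ ≡ + 1 ℤ.* (x ℤ.- (x ℤ.- + 3 ℤ.* t ℤ.* b))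
    ring = ℤ-Solver.solve-∀
  ...   | inj₁ t≡0  = contradiction t≡0 t≢0
  ...   | inj₂ refl = ℤ.+-injective (trans (ℤ.pos-* 4 u) (trans
    (ℤ.*-cancelˡ-≡ (+ 6) _ _ (linear₂ (ℤ.- + 1) C (ring x t C (+ u) N) rx f)) (sym (ℤ.pos-* c n))))
    where
    ring : ∀ x t c u n → + 6 ℤ.* (+ 4 ℤ.* u) ℤ.- + 6 ℤ.* (c ℤ.* n) ≡
      (ℤ.- + 1) ℤ.* (c ℤ.* (x ℤ.* x) ℤ.- (+ 24 ℤ.* u ℤ.+ c)) ℤ.+
      c ℤ.* (x ℤ.* (x ℤ.- + 3 ℤ.* t ℤ.* 0ℤ) ℤ.+ + 12 ℤ.* (0ℤ ℤ.* 0ℤ) ℤ.- (+ 6 ℤ.* n ℤ.+ + 1))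
    ring = ℤ-Solver.solve-∀
  Conjugate-fixed⁻ {u} (conjugate x _ b refl rx rx′ f) | inj₂ x≡-x′ = contradiction
    (linear₂ {p′ = x} (+ 4) (ℤ.- (+ 2 ℤ.* x ℤ.- + 3 ℤ.* t ℤ.* b)) (ring x t b N) f x≡-x′)
    (dk≢r (from-no (+ 3 ℤ∣.∣? + 4)) (+ 16 ℤ.* (b ℤ.* b) ℤ.- + 3 ℤ.* (t ℤ.* b) ℤ.* (t ℤ.* b) ℤ.- + 8 ℤ.* N))
    where
    ring : ∀ x t b n → let x′ = x ℤ.- + 3 ℤ.* t ℤ.* b in
      + 3 ℤ.* (+ 16 ℤ.* (b ℤ.* b) ℤ.- + 3 ℤ.* (t ℤ.* b) ℤ.* (t ℤ.* b) ℤ.- + 8 ℤ.* n) ℤ.- + 4 ≡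
      + 4 ℤ.* (x ℤ.* x′ ℤ.+ + 12 ℤ.* (b ℤ.* b) ℤ.- (+ 6 ℤ.* n ℤ.+ + 1)) ℤ.+
      (ℤ.- (+ 2 ℤ.* x ℤ.- + 3 ℤ.* t ℤ.* b)) ℤ.* (x ℤ.- (ℤ.- x′))
    ring = ℤ-Solver.solve-∀

  Conjugate-fixed⁺ : ∀ {u} x → Root C (+ u) x → 4 * u ≡ c * n → Conjugate u u
  Conjugate-fixed⁺ {u} x rx 4u≡cn = conjugate x x 0ℤ (ring₁ x t) rx rx (ℤ.*-cancelˡ-≡ C _ _ {{ℤ.≢-nonZero C≢0}}
    (linear₂ (+ 1) (+ 6) (ring₂ x C (+ u) N) rx
      (trans (sym (ℤ.pos-* 4 u)) (trans (cong +_ 4u≡cn) (ℤ.pos-* c n)))))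
    where
    ring₁ : ∀ x t → x ≡ x ℤ.- + 3 ℤ.* t ℤ.* 0ℤ
    ring₁ = ℤ-Solver.solve-∀
    ring₂ : ∀ x c u n → c ℤ.* (x ℤ.* x ℤ.+ + 12 ℤ.* (0ℤ ℤ.* 0ℤ)) ℤ.- c ℤ.* (+ 6 ℤ.* n ℤ.+ + 1) ≡
      + 1 ℤ.* (c ℤ.* (x ℤ.* x) ℤ.- (+ 24 ℤ.* u ℤ.+ c)) ℤ.+ + 6 ℤ.* (+ 4 ℤ.* u ℤ.- c ℤ.* n)
    ring₂ = ℤ-Solver.solve-∀

  -- The sign of y is determined by x - y ≡ 0 mod 4 s.
  form-solution : ∀ u v x y → u ℤ.+ v ≡ + k → Root C u x → Root (+ 3) v y →
    ∃ λ b → x ℤ.* (x ℤ.- + 3 ℤ.* t ℤ.* b) ℤ.+ + 12 ℤ.* (b ℤ.* b) ≡ + 6 ℤ.* N ℤ.+ + 1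
  form-solution u v x y u+v≡k rx ry = signed (split X Y (x ℤ.* x ℤ.- (+ 6 ℤ.* N ℤ.+ + 1)) factored)
    where
    odd-x = odd-root u x h (subst (λ c → Root c u x) c-odd rx)
    odd-y = odd-root v y (+ 1) ry
    X = proj₁ odd-x
    Y = proj₁ odd-y
    total : C ℤ.* (x ℤ.* x) ℤ.+ + 3 ℤ.* (y ℤ.* y) ≡ + 4 ℤ.* (s ℤ.* s) ℤ.* (+ 6 ℤ.* N ℤ.+ + 1)
    total = trans (trans (cong₂ ℤ._+_ rx ry) (linear₁ {b = + 24 ℤ.* + k ℤ.+ (C ℤ.+ + 3)} (+ 24) (ring u v C (+ k)) u+v≡k)) size
      where
      ring : ∀ u v c k → + 24 ℤ.* u ℤ.+ c ℤ.+ (+ 24 ℤ.* v ℤ.+ + 3) ℤ.- (+ 24 ℤ.* k ℤ.+ (c ℤ.+ + 3)) ≡ + 24 ℤ.* (u ℤ.+ v ℤ.- k)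
      ring = ℤ-Solver.solve-∀
    -- Four times either side is 3 (x² - y²) = (c + 3) x² - (c x² + 3 y²).
    factored : + 3 ℤ.* (X ℤ.- Y) ℤ.* (X ℤ.+ Y ℤ.+ + 1) ≡ s ℤ.* s ℤ.* (x ℤ.* x ℤ.- (+ 6 ℤ.* N ℤ.+ + 1))
    factored = ℤ.*-cancelˡ-≡ (+ 4) (+ 3 ℤ.* (X ℤ.- Y) ℤ.* (X ℤ.+ Y ℤ.+ + 1)) (s ℤ.* s ℤ.* (x ℤ.* x ℤ.- (+ 6 ℤ.* N ℤ.+ + 1))) (trans (trans (ring₀ X Y)
      (cong₂ (λ x y → + 3 ℤ.* (x ℤ.* x ℤ.- y ℤ.* y)) (sym (proj₂ odd-x)) (sym (proj₂ odd-y))))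
      (linear₂ (ℤ.- + 1) (x ℤ.* x) (ring C s x y N) total c+3))
      where
      ring₀ : ∀ X Y → + 4 ℤ.* (+ 3 ℤ.* (X ℤ.- Y) ℤ.* (X ℤ.+ Y ℤ.+ + 1)) ≡
        + 3 ℤ.* ((+ 2 ℤ.* X ℤ.+ + 1) ℤ.* (+ 2 ℤ.* X ℤ.+ + 1) ℤ.- (+ 2 ℤ.* Y ℤ.+ + 1) ℤ.* (+ 2 ℤ.* Y ℤ.+ + 1))
      ring₀ = ℤ-Solver.solve-∀
      ring : ∀ c s x y n →
        + 3 ℤ.* (x ℤ.* x ℤ.- y ℤ.* y) ℤ.- + 4 ℤ.* (s ℤ.* s ℤ.* (x ℤ.* x ℤ.- (+ 6 ℤ.* n ℤ.+ + 1))) ≡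
        (ℤ.- + 1) ℤ.* (c ℤ.* (x ℤ.* x) ℤ.+ + 3 ℤ.* (y ℤ.* y) ℤ.- + 4 ℤ.* (s ℤ.* s) ℤ.* (+ 6 ℤ.* n ℤ.+ + 1)) ℤ.+
        x ℤ.* x ℤ.* (c ℤ.+ + 3 ℤ.- + 4 ℤ.* (s ℤ.* s))
      ring = ℤ-Solver.solve-∀
    conclude : ∀ b → (x ℤ.- + 4 ℤ.* s ℤ.* b) ℤ.* (x ℤ.- + 4 ℤ.* s ℤ.* b) ≡ y ℤ.* y →
      x ℤ.* (x ℤ.- + 3 ℤ.* t ℤ.* b) ℤ.+ + 12 ℤ.* (b ℤ.* b) ≡ + 6 ℤ.* N ℤ.+ + 1
    conclude b y²≡ = ℤ.*-cancelˡ-≡ (s ℤ.* s) _ _ {{ℤ.≢-nonZero s²≢0}}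
      (ℤ.*-cancelˡ-≡ (+ 4) _ _ (trans (sym (ℤ.*-assoc (+ 4) (s ℤ.* s) _)) (trans (sym (form-identity x b))
        (trans (cong (λ q → C ℤ.* (x ℤ.* x) ℤ.+ + 3 ℤ.* q) y²≡) (trans total (ℤ.*-assoc (+ 4) (s ℤ.* s) _))))))
      where
      s²≢0 : s ℤ.* s ≢ 0ℤ
      s²≢0 eq with ℤ.i*j≡0⇒i≡0∨j≡0 s eq
      ... | inj₁ s≡0 = s≢0 s≡0
      ... | inj₂ s≡0 = s≢0 s≡0
    signed : (∃ λ b → X ℤ.- Y ≡ + 2 ℤ.* s ℤ.* b ⊎ X ℤ.+ Y ℤ.+ + 1 ≡ + 2 ℤ.* s ℤ.* b) →
      ∃ λ b → x ℤ.* (x ℤ.- + 3 ℤ.* t ℤ.* b) ℤ.+ + 12 ℤ.* (b ℤ.* b) ≡ + 6 ℤ.* N ℤ.+ + 1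
    signed (b , inj₁ eq) = b , conclude b (cong (λ z → z ℤ.* z) (trans (cong (ℤ._- + 4 ℤ.* s ℤ.* b) (proj₂ odd-x))
      (trans (linear₁ {b = + 2 ℤ.* Y ℤ.+ + 1} (+ 2) (ring X Y s b) eq) (sym (proj₂ odd-y)))))
      where
      ring : ∀ X Y s b → + 2 ℤ.* X ℤ.+ + 1 ℤ.- + 4 ℤ.* s ℤ.* b ℤ.- (+ 2 ℤ.* Y ℤ.+ + 1) ≡ + 2 ℤ.* (X ℤ.- Y ℤ.- + 2 ℤ.* s ℤ.* b)
      ring = ℤ-Solver.solve-∀
    signed (b , inj₂ eq) = b , conclude b (trans (cong (λ z → z ℤ.* z) (trans (cong (ℤ._- + 4 ℤ.* s ℤ.* b) (proj₂ odd-x))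
      (trans (linear₁ {b = ℤ.- (+ 2 ℤ.* Y ℤ.+ + 1)} (+ 2) (ring X Y s b) eq) (cong ℤ.-_ (sym (proj₂ odd-y)))))) (ring₂ y))
      where
      ring : ∀ X Y s b → + 2 ℤ.* X ℤ.+ + 1 ℤ.- + 4 ℤ.* s ℤ.* b ℤ.- (ℤ.- (+ 2 ℤ.* Y ℤ.+ + 1)) ≡ + 2 ℤ.* (X ℤ.+ Y ℤ.+ + 1 ℤ.- + 2 ℤ.* s ℤ.* b)
      ring = ℤ-Solver.solve-∀
      ring₂ : ∀ y → (ℤ.- y) ℤ.* (ℤ.- y) ≡ y ℤ.* y
      ring₂ = ℤ-Solver.solve-∀

  1≤c : 1 ≤ c
  1≤c = ℕ.n≢0⇒n>0 λ { refl → C≢0 refl }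

  term : ℕ → Bool
  term u = coeff (θ c) u ∧ coeff (θ 3) (k ∸ u)

  conjugate-square : ∀ x b → x ℤ.* (x ℤ.- + 3 ℤ.* t ℤ.* b) ℤ.+ + 12 ℤ.* (b ℤ.* b) ≡ + 6 ℤ.* N ℤ.+ + 1 →
    let x′ = x ℤ.- + 3 ℤ.* t ℤ.* b in ∃ λ e → x′ ℤ.* x′ ≡ + 24 ℤ.* + e ℤ.+ + 1
  conjugate-square x b form =
    divisor-square-mod-24 (x ℤ.- + 3 ℤ.* t ℤ.* b) x (N ℤ.- + 2 ℤ.* (b ℤ.* b)) (linear₁ (+ 1) (ring x t b N) form)
    where
    ring : ∀ x t b n → (x ℤ.- + 3 ℤ.* t ℤ.* b) ℤ.* x ℤ.- (+ 6 ℤ.* (n ℤ.- + 2 ℤ.* (b ℤ.* b)) ℤ.+ + 1) ≡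
      + 1 ℤ.* (x ℤ.* (x ℤ.- + 3 ℤ.* t ℤ.* b) ℤ.+ + 12 ℤ.* (b ℤ.* b) ℤ.- (+ 6 ℤ.* n ℤ.+ + 1))
    ring = ℤ-Solver.solve-∀

  conjugate-term : ∀ u x b → Root C (+ u) x →
    let x′ = x ℤ.- + 3 ℤ.* t ℤ.* b in
    x ℤ.* x′ ℤ.+ + 12 ℤ.* (b ℤ.* b) ≡ + 6 ℤ.* N ℤ.+ + 1 →
    (∃ λ e → x′ ℤ.* x′ ≡ + 24 ℤ.* + e ℤ.+ + 1) →
    ∃ λ u′ → u′ < suc k × T (term u′) × Conjugate u u′
  conjugate-term u x b rx form (e , x′²≡) =
    c * e , s≤s u′≤k , Equivalence.from 𝔹.T-∧
      (θ⁺ {c} {c * e} ℤ.∣ x′ ∣ 1≤c (root⁻ {c} {c * e} x′ root′) ,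
       θ⁺ {3} {k ∸ c * e} ℤ.∣ y′ ∣ (s≤s z≤n) (root⁻ {3} {k ∸ c * e} y′ rooty′)) ,
    conjugate x x′ b refl rx root′ form
    where
    x′ = x ℤ.- + 3 ℤ.* t ℤ.* b
    -- The companion root belongs to the conjugate pair (x′, -b), for which `form-identity` gives
    -- the same total.
    y′ = x′ ℤ.- + 4 ℤ.* s ℤ.* (ℤ.- b)
    root′ : Root C (+ (c * e)) x′
    root′ = trans (cong (C ℤ.*_) x′²≡) (trans (ring′ C (+ e)) (cong (λ ce → + 24 ℤ.* ce ℤ.+ C) (sym (ℤ.pos-* c e))))
      where
      ring′ : ∀ c e → c ℤ.* (+ 24 ℤ.* e ℤ.+ + 1) ≡ + 24 ℤ.* (c ℤ.* e) ℤ.+ c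
      ring′ = ℤ-Solver.solve-∀
    total′ : C ℤ.* (x′ ℤ.* x′) ℤ.+ + 3 ℤ.* (y′ ℤ.* y′) ≡ + 24 ℤ.* + k ℤ.+ (C ℤ.+ + 3)
    total′ = trans (form-identity x′ (ℤ.- b)) (trans (cong (+ 4 ℤ.* (s ℤ.* s) ℤ.*_) (trans (ring′ x t b) form)) (sym size))
      where
      ring′ : ∀ x t b → let x′ = x ℤ.- + 3 ℤ.* t ℤ.* b in
        x′ ℤ.* (x′ ℤ.- + 3 ℤ.* t ℤ.* (ℤ.- b)) ℤ.+ + 12 ℤ.* ((ℤ.- b) ℤ.* (ℤ.- b)) ≡ x ℤ.* x′ ℤ.+ + 12 ℤ.* (b ℤ.* b)
      ring′ = ℤ-Solver.solve-∀
    rooty : Root (+ 3) (+ k ℤ.- + (c * e)) y′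
    rooty = linear₂ {p′ = C ℤ.* (x′ ℤ.* x′)} (+ 1) (ℤ.- + 1) (ring′ C (x′ ℤ.* x′) (y′ ℤ.* y′) (+ k) (+ (c * e))) total′ root′
      where
      ring′ : ∀ c p q k u → + 3 ℤ.* q ℤ.- (+ 24 ℤ.* (k ℤ.- u) ℤ.+ + 3) ≡
        + 1 ℤ.* (c ℤ.* p ℤ.+ + 3 ℤ.* q ℤ.- (+ 24 ℤ.* k ℤ.+ (c ℤ.+ + 3))) ℤ.+ (ℤ.- + 1) ℤ.* (c ℤ.* p ℤ.- (+ 24 ℤ.* u ℤ.+ c))
      ring′ = ℤ-Solver.solve-∀
    u′≤k : c * e ≤ k
    u′≤k = ℤ.drop‿+≤+ (ℤ.0≤i-j⇒j≤i (root₃-nonneg (+ k ℤ.- + (c * e)) y′ rooty))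
    rooty′ : Root (+ 3) (+ (k ∸ c * e)) y′
    rooty′ = subst (λ v → Root (+ 3) v y′) (trans (ℤ.m-n≡m⊖n k (c * e)) (ℤ.⊖-≥ u′≤k)) rooty

  partner : ∀ {u} → u < suc k → T (term u) → ∃ λ u′ → u′ < suc k × T (term u′) × Conjugate u u′
  partner {u} (s≤s u≤k) tu =
    let θu , θv = Equivalence.to 𝔹.T-∧ tu
        x , rx = θ⁻ {c} {u} θu
        y , ry = θ⁻ {3} {k ∸ u} θv
        b , form = form-solution (+ u) (+ (k ∸ u)) (+ x) (+ y)
          (trans (sym (ℤ.pos-+ u (k ∸ u))) (cong +_ (ℕ.m+[n∸m]≡n u≤k)))
          (root⁺ {c} {u} {x} rx) (root⁺ {3} {k ∸ u} {y} ry)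
    in conjugate-term u (+ x) b (root⁺ {c} {u} {x} rx) form (conjugate-square (+ x) b form)

  θ-product : coeff (θ c ⊛ θ 3) k ≡ ∑ (suc k) (λ u → term u ∧ (4 * u ≡ᵇ c * n))
  θ-product = ∑-involution (suc k) term (λ u → 4 * u ≡ᵇ c * n) Conjugate
    Conjugate-sym Conjugate-functional partner λ {u} tu → mk⇔
      (λ f → ℕ.≡⇒≡ᵇ (4 * u) (c * n) (Conjugate-fixed⁻ f))
      (λ eq → let x , rx = θ⁻ {c} {u} (proj₁ (Equivalence.to 𝔹.T-∧ tu)) in
        Conjugate-fixed⁺ (+ x) (root⁺ {c} {u} {x} rx) (ℕ.≡ᵇ⇒≡ (4 * u) (c * n) eq))

-- Evaluation of the two theta products.

θ₄-square : ∀ {n x} → 4 * (x * x) ≡ 24 * n + 4 → x * x ≡ 6 * n + 1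
θ₄-square {n} {x} eq = ℕ.*-cancelˡ-≡ _ _ 4 (trans eq
  (solve 1 (λ n → con 24 :* n :+ con 4 := con 4 :* (con 6 :* n :+ con 1)) refl n))
  where open ℕ-Solver

-- x² = 6 n + 1 makes x prime to 6, so x² is 1 modulo 24 and 4 divides n. This is the source of θ 4
-- = θ 1 (q⁴).
θ₄-support : ∀ {n x} → 4 * (x * x) ≡ 24 * n + 4 → ∃ λ e → n ≡ 4 * e × x * x ≡ 24 * e + 1
θ₄-support {n} {x} eq = e , ℕ.*-cancelˡ-≡ n (4 * e) 6 (ℕ.+-cancelʳ-≡ 1 (6 * n) (6 * (4 * e))
    (trans (sym x²≡6n+1) (trans x²≡24e+1 (cong (_+ 1) (ℕ.*-assoc 6 4 e))))) , x²≡24e+1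
  where
  x²≡6n+1 : x * x ≡ 6 * n + 1
  x²≡6n+1 = θ₄-square {n} {x} eq
  divisor : ∃ λ e → + x ℤ.* + x ≡ + 24 ℤ.* + e ℤ.+ + 1
  divisor = divisor-square-mod-24 (+ x) (+ x) (+ n)
    (trans (sym (ℤ.pos-* x x)) (trans (cong +_ x²≡6n+1) (cong (ℤ._+ + 1) (ℤ.pos-* 6 n))))
  e = proj₁ divisor
  x²≡24e+1 : x * x ≡ 24 * e + 1
  x²≡24e+1 = ℤ.+-injective (trans (ℤ.pos-* x x) (trans (proj₂ divisor) (cong (ℤ._+ + 1) (sym (ℤ.pos-* 24 e)))))

-- At a fixed point b = 0, so x = y and the indices u and k - u are in the ratio c : 3. With n = 4 e
-- they are c e and 3 e, so the surviving sum has at most one term.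
θ⊛θ₃ : ∀ s t h c k n → + c ≡ + 2 ℤ.* h ℤ.+ + 1 → s ℤ.* t ≡ + 2 → + c ℤ.+ + 3 ≡ + 4 ℤ.* (s ℤ.* s) →
  4 * k ≡ (c + 3) * n →
  (∀ X Y W → + 3 ℤ.* (X ℤ.- Y) ℤ.* (X ℤ.+ Y ℤ.+ + 1) ≡ s ℤ.* s ℤ.* W →
    ∃ λ b → X ℤ.- Y ≡ + 2 ℤ.* s ℤ.* b ⊎ X ℤ.+ Y ℤ.+ + 1 ≡ + 2 ℤ.* s ℤ.* b) →
  coeff (θ c ⊛ θ 3) k ≡ coeff (θ 4) n
θ⊛θ₃ s t h c k n c-odd st c+3 k-size split = trans θ-product (T-ext to from)
  where
  open Conjugation s t h c k n c-odd st c+3 k-size split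
  open ℕ-Solver
  term₄ : ℕ → Bool
  term₄ u = term u ∧ (4 * u ≡ᵇ c * n)
  root₄ : ∀ u x → c * (x * x) ≡ 24 * u + c → 4 * u ≡ c * n → 4 * (x * x) ≡ 24 * n + 4
  root₄ u x rx 4u≡cn = ℕ.*-cancelˡ-≡ _ _ c {{>-nonZero 1≤c}} (begin
      c * (4 * (x * x))     ≡⟨ solve 2 (λ c q → c :* (con 4 :* q) := con 4 :* (c :* q)) refl c (x * x) ⟩
      4 * (c * (x * x))     ≡⟨ cong (4 *_) rx ⟩
      4 * (24 * u + c)      ≡⟨ solve 2 (λ u c → con 4 :* (con 24 :* u :+ c) := con 24 :* (con 4 :* u) :+ con 4 :* c) refl u c ⟩
      24 * (4 * u) + 4 * c  ≡⟨ cong (λ w → 24 * w + 4 * c) 4u≡cn ⟩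
      24 * (c * n) + 4 * c  ≡⟨ solve 2 (λ n c → con 24 :* (c :* n) :+ con 4 :* c := c :* (con 24 :* n :+ con 4)) refl n c ⟩
      c * (24 * n + 4)      ∎)
    where open ≡-Reasoning
  to : T (∑ (suc k) term₄) → T (coeff (θ 4) n)
  to t =
    let u , _ , tu = ∑-true (suc k) {term₄} t
        χu , du = Equivalence.to (𝔹.T-∧ {term u}) tu
        x , rx = θ⁻ {c} {u} (proj₁ (Equivalence.to (𝔹.T-∧ {coeff (θ c) u}) χu))
    in θ⁺ {4} {n} x (s≤s z≤n) (root₄ u x rx (ℕ.≡ᵇ⇒≡ (4 * u) (c * n) du))
  from′ : ∀ e x → n ≡ 4 * e → x * x ≡ 24 * e + 1 → T (∑ (suc k) term₄)
  from′ e x n≡4e x²≡ =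
    Equivalence.from 𝔹.T-≡ (∑-unique (suc k) {term₄} {c * e} (s≤s (subst (c * e ≤_) (sym k≡) (ℕ.m≤m+n (c * e) (3 * e))))
      (Equivalence.from 𝔹.T-∧ (Equivalence.from 𝔹.T-∧ (θ⁺ {c} {c * e} x 1≤c (scaled c) ,
          θ⁺ {3} {k ∸ c * e} x (s≤s z≤n) (trans (scaled 3) (cong (λ v → 24 * v + 3) (sym k∸≡))))
        , ℕ.≡⇒≡ᵇ (4 * (c * e)) (c * n) (sym cn≡)))
      λ i _ ti → ℕ.*-cancelˡ-≡ i (c * e) 4 (trans (ℕ.≡ᵇ⇒≡ (4 * i) (c * n) (proj₂ (Equivalence.to (𝔹.T-∧ {term i}) ti))) cn≡))
    where
    cn≡ : c * n ≡ 4 * (c * e)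
    cn≡ = trans (cong (c *_) n≡4e) (solve 2 (λ c e → c :* (con 4 :* e) := con 4 :* (c :* e)) refl c e)
    k≡ : k ≡ c * e + 3 * e
    k≡ = ℕ.*-cancelˡ-≡ k _ 4 (trans (trans k-size (cong ((c + 3) *_) n≡4e))
      (solve 2 (λ c e → (c :+ con 3) :* (con 4 :* e) := con 4 :* (c :* e :+ con 3 :* e)) refl c e))
    k∸≡ : k ∸ c * e ≡ 3 * e
    k∸≡ = trans (cong (_∸ c * e) k≡) (ℕ.m+n∸m≡n (c * e) (3 * e))
    scaled : ∀ d → d * (x * x) ≡ 24 * (d * e) + d
    scaled d = trans (cong (d *_) x²≡) (solve 2 (λ d e → d :* (con 24 :* e :+ con 1) := con 24 :* (d :* e) :+ d) refl d e)
  from : T (coeff (θ 4) n) → T (∑ (suc k) term₄)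
  from t =
    let x , rx = θ⁻ {4} {n} t
        e , n≡4e , x²≡ = θ₄-support {n} {x} rx
    in from′ e x n≡4e x²≡

θ₁⊛θ₃≈θ₄ : θ 1 ⊛ θ 3 ≈ θ 4
θ₁⊛θ₃≈θ₄ .at n = θ⊛θ₃ (+ 1) (+ 2) (+ 0) 1 n n refl refl refl refl split
  where
  ring : ∀ X Y e → X ℤ.+ Y ℤ.+ + 1 ℤ.- + 2 ℤ.* + 1 ℤ.* (e ℤ.+ Y ℤ.+ + 1) ≡ + 1 ℤ.* (X ℤ.- Y ℤ.- (+ 2 ℤ.* e ℤ.+ + 1))
  ring = ℤ-Solver.solve-∀
  split : ∀ X Y W → + 3 ℤ.* (X ℤ.- Y) ℤ.* (X ℤ.+ Y ℤ.+ + 1) ≡ + 1 ℤ.* + 1 ℤ.* W →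
    ∃ λ b → X ℤ.- Y ≡ + 2 ℤ.* + 1 ℤ.* b ⊎ X ℤ.+ Y ℤ.+ + 1 ≡ + 2 ℤ.* + 1 ℤ.* b
  -- X - Y and X + Y + 1 have the odd sum 2 X + 1, so one of them is even.
  split X Y _ _ with even-or-odd (X ℤ.- Y)
  ... | e , inj₁ eq = e , inj₁ eq
  ... | e , inj₂ eq = e ℤ.+ Y ℤ.+ + 1 , inj₂ (linear₁ (+ 1) (ring X Y e) eq)

θ₁₃⊛θ₃ : ∀ n → coeff (θ 13 ⊛ θ 3) (n * 4) ≡ coeff (θ 4) n
θ₁₃⊛θ₃ n = θ⊛θ₃ (+ 2) (+ 1) (+ 6) 13 (n * 4) n refl refl refl
  (solve 1 (λ n → con 4 :* (n :* con 4) := con 16 :* n) refl n) split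
  where
  open ℕ-Solver
  ring₁ : ∀ X Y W e → X ℤ.- Y ℤ.- + 2 ℤ.* + 2 ℤ.* (W ℤ.- + 3 ℤ.* e ℤ.* (e ℤ.+ Y) ℤ.- e) ≡
    + 1 ℤ.* (+ 3 ℤ.* (X ℤ.- Y) ℤ.* (X ℤ.+ Y ℤ.+ + 1) ℤ.- + 2 ℤ.* + 2 ℤ.* W) ℤ.+
    (ℤ.- (+ 3 ℤ.* (X ℤ.- Y) ℤ.+ + 6 ℤ.* Y ℤ.+ + 2 ℤ.+ + 6 ℤ.* e)) ℤ.* (X ℤ.- Y ℤ.- + 2 ℤ.* e)
  ring₁ = ℤ-Solver.solve-∀
  ring₂ : ∀ X Y W e → X ℤ.+ Y ℤ.+ + 1 ℤ.- + 2 ℤ.* + 2 ℤ.* (W ℤ.- + 3 ℤ.* e ℤ.* (e ℤ.+ Y ℤ.+ + 1) ℤ.- (e ℤ.+ Y ℤ.+ + 1)) ≡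
    + 1 ℤ.* (+ 3 ℤ.* (X ℤ.- Y) ℤ.* (X ℤ.+ Y ℤ.+ + 1) ℤ.- + 2 ℤ.* + 2 ℤ.* W) ℤ.+
    (ℤ.- (+ 2 ℤ.+ + 6 ℤ.* e ℤ.+ + 6 ℤ.* (e ℤ.+ Y ℤ.+ + 1) ℤ.+ + 3 ℤ.* (X ℤ.- Y ℤ.- + 2 ℤ.* e ℤ.- + 1))) ℤ.* (X ℤ.- Y ℤ.- (+ 2 ℤ.* e ℤ.+ + 1))
  ring₂ = ℤ-Solver.solve-∀
  split : ∀ X Y W → + 3 ℤ.* (X ℤ.- Y) ℤ.* (X ℤ.+ Y ℤ.+ + 1) ≡ + 2 ℤ.* + 2 ℤ.* W →
    ∃ λ b → X ℤ.- Y ≡ + 2 ℤ.* + 2 ℤ.* b ⊎ X ℤ.+ Y ℤ.+ + 1 ≡ + 2 ℤ.* + 2 ℤ.* b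
  -- One factor is odd, so 4 divides the other. For X - Y = 2 e the hypothesis reads 3 e (2 (e + Y)
  -- + 1) = 2 W, whence e = 2 (W - 3 e (e + Y) - e). The other case is the same with X + Y + 1 = 2
  -- (e + Y + 1).
  split X Y W eq with even-or-odd (X ℤ.- Y)
  ... | e , inj₁ X-Y≡ = W ℤ.- + 3 ℤ.* e ℤ.* (e ℤ.+ Y) ℤ.- e , inj₁
    (linear₂ (+ 1) (ℤ.- (+ 3 ℤ.* (X ℤ.- Y) ℤ.+ + 6 ℤ.* Y ℤ.+ + 2 ℤ.+ + 6 ℤ.* e)) (ring₁ X Y W e) eq X-Y≡)
  ... | e , inj₂ X-Y≡ = W ℤ.- + 3 ℤ.* e ℤ.* (e ℤ.+ Y ℤ.+ + 1) ℤ.- (e ℤ.+ Y ℤ.+ + 1) , inj₂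
    (linear₂ (+ 1) (ℤ.- (+ 2 ℤ.+ + 6 ℤ.* e ℤ.+ + 6 ℤ.* (e ℤ.+ Y ℤ.+ + 1) ℤ.+ + 3 ℤ.* (X ℤ.- Y ℤ.- + 2 ℤ.* e ℤ.- + 1)))
      (ring₂ X Y W e) eq X-Y≡)

-- Extraction of every fourth coefficient.

every-fourth : Series → Series
every-fourth f .coeff n = coeff f (n * 4)

-- The hypotheses say g = h (q⁴), and a series in q⁴ can be pulled out of the extraction: of each
-- four successive coefficients of f only the first meets a nonzero one of g.
every-fourth-⊛ : ∀ f g h → (∀ n → coeff g (n * 4) ≡ coeff h n) → (∀ n r → r < 3 → coeff g (suc r + n * 4) ≡ false) →
  every-fourth (f ⊛ g) ≈ every-fourth f ⊛ h
every-fourth-⊛ f g h g≡h g≡0 .at n = go n f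
  where
  open ≡-Reasoning
  go : ∀ n f → coeff (f ⊛ g) (n * 4) ≡ coeff (every-fourth f ⊛ h) n
  go zero    f = cong (λ a → coeff f 0 ∧ a xor false) (g≡h 0)
  go (suc n) f = begin
    f₀ ∧ coeff g (suc n * 4) xor (f₁ ∧ coeff g (3 + n * 4) xor (f₂ ∧ coeff g (2 + n * 4) xor
      (f₃ ∧ coeff g (1 + n * 4) xor coeff (tail (tail (tail (tail f))) ⊛ g) (n * 4))))
      ≡⟨ cong₂ _xor_ (cong (f₀ ∧_) (g≡h (suc n))) (trans (vanish f₁ 2 (s≤s (s≤s (s≤s z≤n))))
           (trans (vanish f₂ 1 (s≤s (s≤s z≤n))) (trans (vanish f₃ 0 (s≤s z≤n)) (go n (tail (tail (tail (tail f)))))))) ⟩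
    f₀ ∧ coeff h (suc n) xor coeff (every-fourth (tail (tail (tail (tail f)))) ⊛ h) n ∎
    where
    f₀ = coeff f 0
    f₁ = coeff f 1
    f₂ = coeff f 2
    f₃ = coeff f 3
    vanish : ∀ a r {z} → r < 3 → a ∧ coeff g (suc r + n * 4) xor z ≡ z
    vanish a r {z} r<3 = cong (_xor z) (trans (cong (a ∧_) (g≡0 n r r<3)) (𝔹.∧-zeroʳ a))

θ₄-multiple : ∀ n → coeff (θ 4) (n * 4) ≡ coeff (θ 1) n
θ₄-multiple n = T-ext
  (λ t → let x , rx = θ⁻ {4} {n * 4} t in θ⁺ {1} {n} x (s≤s z≤n)
    (ℕ.*-cancelˡ-≡ _ _ 4 (trans (cong (4 *_) (ℕ.*-identityˡ (x * x))) (trans rx (expand n)))))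
  (λ t → let x , rx = θ⁻ {1} {n} t in θ⁺ {4} {n * 4} x (s≤s z≤n)
    (trans (cong (4 *_) (trans (sym (ℕ.*-identityˡ (x * x))) rx)) (sym (expand n))))
  where
  open ℕ-Solver
  expand : ∀ n → 24 * (n * 4) + 4 ≡ 4 * (24 * n + 1)
  expand = solve 1 (λ n → con 24 :* (n :* con 4) :+ con 4 := con 4 :* (con 24 :* n :+ con 1)) refl

θ₄-nonmultiple : ∀ n r → r < 3 → coeff (θ 4) (suc r + n * 4) ≡ false
θ₄-nonmultiple n r r<3 = ¬T⇒false λ t →
  let x , rx = θ⁻ {4} {suc r + n * 4} t
      e , eq , _ = θ₄-support {suc r + n * 4} {x} rx
  in >⇒∤ (s≤s r<3) (∣m+n∣m⇒∣n (subst (4 ∣_) (trans (sym eq) (ℕ.+-comm (suc r) (n * 4))) (m∣m*n e)) (n∣m*n n))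

open GeneratingFunction 13 using (B; B⊛θ₁≈θ)

every-fourth-B : every-fourth B ≈ θ 3
every-fourth-B = ⊛-cancelʳ {h = θ 1} (Equivalence.to 𝔹.T-≡ (θ⁺ {1} {0} 1 (s≤s z≤n) refl)) (begin
  every-fourth B ⊛ θ 1               ≈⟨ every-fourth-⊛ B (θ 4) (θ 1) θ₄-multiple θ₄-nonmultiple ⟨
  every-fourth (B ⊛ θ 4)             ≈⟨ every-fourth-cong (⊛-cong ≈-refl θ₁⊛θ₃≈θ₄) ⟨
  every-fourth (B ⊛ (θ 1 ⊛ θ 3))     ≈⟨ every-fourth-cong (⊛-assoc B (θ 1) (θ 3)) ⟨
  every-fourth ((B ⊛ θ 1) ⊛ θ 3)     ≈⟨ every-fourth-cong (⊛-cong (B⊛θ₁≈θ (from-no (2 ∣? 13)) (from-no (3 ∣? 13))) ≈-refl) ⟩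
  every-fourth (θ 13 ⊛ θ 3)          ≈⟨ pointwise θ₁₃⊛θ₃ ⟩
  θ 4                                ≈⟨ θ₁⊛θ₃≈θ₄ ⟨
  θ 1 ⊛ θ 3                          ≈⟨ ⊛-comm (θ 1) (θ 3) ⟩
  θ 3 ⊛ θ 1                          ∎)
  where
  open ≈-Reasoning
  every-fourth-cong : ∀ {f g} → f ≈ g → every-fourth f ≈ every-fourth g
  every-fourth-cong p .at n = at p (n * 4)

b₁₃-even : ∀ m → (∀ y → y * y ≢ 8 * m + 1) → 2 ∣ b 13 (m * 4)
b₁₃-even m nonsquare = even⇒2∣ (b 13 (m * 4)) (trans (at every-fourth-B m) (¬T⇒false λ t →
  let y , ry = θ⁻ {3} {m} t in nonsquare y (ℕ.*-cancelˡ-≡ _ _ 3 (trans ry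
    (solve 1 (λ m → con 24 :* m :+ con 3 := con 3 :* (con 8 :* m :+ con 1)) refl m)))))
  where open ℕ-Solver

-- Squares in the arithmetic progressions

odd-square-mod-8 : ∀ p → 2 ∤ p → ∃ λ e → p * p ≡ 8 * e + 1
odd-square-mod-8 p 2∤p with even-or-odd′ p
  where
  even-or-odd′ : ∀ p → ∃ λ a → p ≡ 2 * a ⊎ p ≡ 2 * a + 1
  even-or-odd′ zero = 0 , inj₁ refl
  even-or-odd′ (suc p) with even-or-odd′ p
  ... | a , inj₁ refl = a , inj₂ (ℕ.+-comm 1 (2 * a))
  ... | a , inj₂ refl = suc a , inj₁ (ℕ-Solver.solve 1 (λ a → ℕ-Solver.con 1 ℕ-Solver.:+ (ℕ-Solver.con 2 ℕ-Solver.:* a ℕ-Solver.:+ ℕ-Solver.con 1)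
      ℕ-Solver.:= ℕ-Solver.con 2 ℕ-Solver.:* (ℕ-Solver.con 1 ℕ-Solver.:+ a)) refl a)
... | a , inj₁ refl = contradiction (m∣m*n a) 2∤p
... | a , inj₂ refl = tri a , (begin
  (2 * a + 1) * (2 * a + 1)    ≡⟨ solve 1 (λ a → (con 2 :* a :+ con 1) :* (con 2 :* a :+ con 1) := con 4 :* (a :* (con 1 :+ a)) :+ con 1) refl a ⟩
  4 * (a * suc a) + 1          ≡⟨ cong (λ w → 4 * w + 1) (2*tri a) ⟨
  4 * (2 * tri a) + 1          ≡⟨ cong (_+ 1) (ℕ.*-assoc 4 2 (tri a)) ⟨
  8 * tri a + 1                ∎)
  where
  open ≡-Reasoning
  open ℕ-Solver

1-mod-8-^ : ∀ {w t} → w ≡ 8 * t + 1 → ∀ α → ∃ λ e → w ^ α ≡ 8 * e + 1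
1-mod-8-^ _ zero = 0 , refl
1-mod-8-^ {w} {t} w≡ (suc α) with e , w^α≡ ← 1-mod-8-^ {w} {t} w≡ α = 8 * t * e + t + e , trans (cong₂ _*_ w≡ w^α≡)
  (solve 2 (λ t e → (con 8 :* t :+ con 1) :* (con 8 :* e :+ con 1) := con 8 :* (con 8 :* t :* e :+ t :+ e) :+ con 1) refl t e)
  where open ℕ-Solver

legendre≡-1⇒nonresidue : ∀ a p .{{_ : NonZero p}} → legendre a p ≡ -1ℤ → ¬ IsSquareMod p a
legendre≡-1⇒nonresidue a p eq with + p ℤ∣.∣? a | isSquareMod? p a
... | yes _ | _     = contradiction eq λ ()
... | no  _ | yes _ = contradiction eq λ ()
... | no  _ | no ¬s = ¬s

module _ {p : ℕ} (p-prime : Prime p) where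

  private instance
    p-nonZero : NonZero p
    p-nonZero = prime⇒nonZero p-prime

  prime-∣-square : ∀ {y} → p ∣ y * y → p ∣ y
  prime-∣-square {y} p∣y² with euclidsLemma y y p-prime p∣y²
  ... | inj₁ p∣y = p∣y
  ... | inj₂ p∣y = p∣y

  ^-2*suc : ∀ α r → p ^ (2 * suc α) * r ≡ p * (p * (p ^ (2 * α) * r))
  ^-2*suc α r = trans (cong (λ e → p ^ e * r) (ℕ.*-suc 2 α))
    (solve 3 (λ p w r → p :* (p :* w) :* r := p :* (p :* (w :* r))) refl p (p ^ (2 * α)) r)
    where open ℕ-Solver

  -- As p divides y², it divides y, so the factors p can be cancelled two at a time.
  square-÷-^ : ∀ α y r → y * y ≡ p ^ (2 * α) * r → ∃ λ z → z * z ≡ r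
  square-÷-^ zero    y r eq = y , trans eq (ℕ.*-identityˡ r)
  square-÷-^ (suc α) y r eq with divides q refl ← prime-∣-square {y} (subst (p ∣_) (sym (trans eq (^-2*suc α r))) (m∣m*n (p * (p ^ (2 * α) * r)))) =
    square-÷-^ α q r (ℕ.*-cancelˡ-≡ (q * q) (p ^ (2 * α) * r) p (ℕ.*-cancelˡ-≡ (p * (q * q)) (p * (p ^ (2 * α) * r)) p (trans (trans
      (solve 2 (λ p q → p :* (p :* (q :* q)) := (q :* p) :* (q :* p)) refl p q) eq) (^-2*suc α r))))
    where open ℕ-Solver

  p∣square⇒p∣quotient : ∀ {z r} → z * z ≡ p * r → p ∣ r
  p∣square⇒p∣quotient {z} {r} eq with divides q refl ← prime-∣-square {z} (subst (p ∣_) (sym eq) (m∣m*n r)) =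
    divides (q * q) (ℕ.*-cancelˡ-≡ r (q * q * p) p (trans (sym eq) (solve 2 (λ p q → (q :* p) :* (q :* p) := p :* (q :* q :* p)) refl p q)))
    where open ℕ-Solver

  odd-prime-∣-8* : 2 ∤ p → ∀ i → p ∣ 8 * i → p ∣ i
  odd-prime-∣-8* 2∤p i p∣8i = cancel-2 (cancel-2 (cancel-2 (subst (p ∣_) (trans (ℕ.*-assoc 2 4 i) (cong (2 *_) (ℕ.*-assoc 2 2 i))) p∣8i)))
    where
    cancel-2 : ∀ {i} → p ∣ 2 * i → p ∣ i
    cancel-2 {i} p∣2i with euclidsLemma 2 i p-prime p∣2i
    ... | inj₂ p∣i = p∣i
    ... | inj₁ p∣2 = contradiction (∣-reflexive (sym (ℕ.≤-antisym (∣⇒≤ p∣2) (nonTrivial⇒n>1 p {{prime⇒nonTrivial p-prime}})))) 2∤p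

1-mod-8-* : ∀ {v w} → (∃ λ e → v ≡ 8 * e + 1) → (∃ λ t → w ≡ 8 * t + 1) → ∃ λ f → v * w ≡ 8 * f + 1
1-mod-8-* (e , v≡) (t , w≡) = 8 * e * t + e + t , trans (cong₂ _*_ v≡ w≡)
  (solve 2 (λ e t → (con 8 :* e :+ con 1) :* (con 8 :* t :+ con 1) := con 8 :* (con 8 :* e :* t :+ e :+ t) :+ con 1) refl e t)
  where open ℕ-Solver

8*+8*+1 : ∀ u f → 8 * u + (8 * f + 1) ≡ 8 * (u + f) + 1
8*+8*+1 = solve 2 (λ u f → con 8 :* u :+ (con 8 :* f :+ con 1) := con 8 :* (u :+ f) :+ con 1) refl
  where open ℕ-Solver

8*[an+w]+1 : ∀ a n w → 8 * (a * n + w) + 1 ≡ 8 * a * n + (8 * w + 1)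
8*[an+w]+1 = solve 3 (λ a n w → con 8 :* (a :* n :+ w) :+ con 1 := con 8 :* a :* n :+ (con 8 :* w :+ con 1)) refl
  where open ℕ-Solver

-- P stands for p^(2 α), and P p² is an even power of an odd number, hence 1 modulo 8. A numerator
-- of the form 8 w + 1 makes its contribution to the argument of `b 13` equal to 4 w.
numerator₁ : ∀ i p P f → P * (p * p) ≡ 8 * f + 1 → (8 * i + p) * (P * p) ≡ 8 * (i * (P * p) + f) + 1
numerator₁ i p P f Pp²≡ = trans
  (solve 3 (λ i p P → (con 8 :* i :+ p) :* (P :* p) := con 8 :* (i :* (P :* p)) :+ P :* (p :* p)) refl i p P)
  (trans (cong (λ u → 8 * (i * (P * p)) + u) Pp²≡) (8*+8*+1 (i * (P * p)) f))
  where open ℕ-Solver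

factored₁ : ∀ i p P n w → (8 * i + p) * (P * p) ≡ 8 * w + 1 →
  8 * (P * (p * p) * n + w) + 1 ≡ P * (p * (p * (8 * n) + (8 * i + p)))
factored₁ i p P n w eq = trans (8*[an+w]+1 (P * (p * p)) n w)
  (trans (cong (λ u → 8 * (P * (p * p)) * n + u) (sym eq))
    (solve 4 (λ P p n i → con 8 :* (P :* (p :* p)) :* n :+ (con 8 :* i :+ p) :* (P :* p)
      := P :* (p :* (p :* (con 8 :* n) :+ (con 8 :* i :+ p)))) refl P p n i))
  where open ℕ-Solver

numerator₂ : ∀ j P e → P ≡ 8 * e + 1 → (8 * j + 1) * P ≡ 8 * (j * P + e) + 1
numerator₂ j P e P≡ = trans (solve 2 (λ j P → (con 8 :* j :+ con 1) :* P := con 8 :* (j :* P) :+ P) refl j P)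
  (trans (cong (λ u → 8 * (j * P) + u) P≡) (8*+8*+1 (j * P) e))
  where open ℕ-Solver

factored₂ : ∀ j p P n w → (8 * j + 1) * P ≡ 8 * w + 1 → 8 * (P * p * n + w) + 1 ≡ P * (8 * n * p + (8 * j + 1))
factored₂ j p P n w eq = trans (8*[an+w]+1 (P * p) n w)
  (trans (cong (λ u → 8 * (P * p) * n + u) (sym eq))
    (solve 4 (λ P p n j → con 8 :* (P :* p) :* n :+ (con 8 :* j :+ con 1) :* P
      := P :* (con 8 :* n :* p :+ (con 8 :* j :+ con 1))) refl P p n j))
  where open ℕ-Solver

residue : ∀ z a m p → z * z ≡ m * p + a → IsSquareMod p (+ a)
residue z a m p eq = + z , ℤ∣.divides (+ m) (linear₁ (+ 1) (ring (+ z ℤ.* + z) (+ a) (+ m ℤ.* + p))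
  (trans (sym (ℤ.pos-* z z)) (trans (cong +_ eq) (cong (ℤ._+ + a) (ℤ.pos-* m p)))))
  where
  ring : ∀ q a u → q ℤ.- a ℤ.- u ≡ + 1 ℤ.* (q ℤ.- (u ℤ.+ a))
  ring = ℤ-Solver.solve-∀

-- E n stands for 2 ∣ b 13 n; it is abstract because unfolding b on these arguments is infeasible.
module Progressions {p : ℕ} (p-prime : Prime p) (2∤p : 2 ∤ p) (α n : ℕ)
  (E : ℕ → Set) (nonsquare⇒E : ∀ m → (∀ y → y * y ≢ 8 * m + 1) → E (m * 4))
  where

  open ℕ-Solver
  private instance
    p-nonZero : NonZero p
    p-nonZero = prime⇒nonZero p-prime

  P = p ^ (2 * α)
  P≡ : ∃ λ e → P ≡ 8 * e + 1
  P≡ =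
    let t , p²≡ = odd-square-mod-8 p 2∤p
        e , eq = 1-mod-8-^ {p ^ 2} {t} (trans (cong (p *_) (ℕ.*-identityʳ p)) p²≡) α
    in e , trans (sym (ℕ.^-*-assoc p 2 α)) eq
  half : ∀ a → (8 * a + 1 ∸ 1) / 2 ≡ 4 * a
  half a = trans (cong (_/ 2) (trans (ℕ.m+n∸n≡m (8 * a) 1) (solve 1 (λ a → con 8 :* a := con 4 :* a :* con 2) refl a))) (m*n/n≡m (4 * a) 2)

  p^-+ : ∀ d w → p ^ d ≡ w → p ^ (2 * α + d) ≡ P * w
  p^-+ d w p^d≡ = trans (ℕ.^-distribˡ-+-* p (2 * α) d) (cong (P *_) p^d≡)
  Q≡ : p ^ (2 * α + 1) ≡ P * p
  Q≡ = p^-+ 1 p (ℕ.*-identityʳ p)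

  even : ∀ a c w → c ≡ 8 * w + 1 → (∀ y → y * y ≢ 8 * (a * n + w) + 1) → E (4 * a * n + (c ∸ 1) / 2)
  even a _ w refl nonsquare = subst E
    (trans (solve 3 (λ a n w → (a :* n :+ w) :* con 4 := con 4 :* a :* n :+ con 4 :* w) refl a n w)
      (cong (λ u → 4 * a * n + u) (sym (half w))))
    (nonsquare⇒E (a * n + w) nonsquare)

  part₁ : ∀ i → 1 ≤ i → i < p → E (4 * p ^ (2 * α + 2) * n + ((8 * i + p) * p ^ (2 * α + 1) ∸ 1) / 2)
  part₁ i 1≤i i<p = subst₂ (λ a q → E (4 * a * n + ((8 * i + p) * q ∸ 1) / 2))
    (sym (p^-+ 2 (p * p) (cong (p *_) (ℕ.*-identityʳ p)))) (sym Q≡)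
    (even (P * (p * p)) ((8 * i + p) * (P * p)) w numerator nonsquare)
    where
    f = proj₁ (1-mod-8-* P≡ (odd-square-mod-8 p 2∤p))
    w = i * (P * p) + f
    numerator : (8 * i + p) * (P * p) ≡ 8 * w + 1
    numerator = numerator₁ i p P f (proj₂ (1-mod-8-* P≡ (odd-square-mod-8 p 2∤p)))
    nonsquare : ∀ y → y * y ≢ 8 * (P * (p * p) * n + w) + 1
    nonsquare y eq =
      let z , z²≡ = square-÷-^ p-prime α y (p * (p * (8 * n) + (8 * i + p)))
                      (trans eq (factored₁ i p P n w numerator))
          -- After division by p^(2 α) one explicit factor p remains, so a square would need a
          -- second p in the cofactor.
          p∣8i+p = ∣m+n∣m⇒∣n (p∣square⇒p∣quotient p-prime {z} z²≡) (m∣m*n (8 * n))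
          p∣8i = ∣m+n∣m⇒∣n (subst (p ∣_) (ℕ.+-comm (8 * i) p) p∣8i+p) ∣-refl
      in >⇒∤ {{>-nonZero 1≤i}} i<p (odd-prime-∣-8* p-prime 2∤p i p∣8i)

  part₂ : ∀ j → j < p → legendre (+ (8 * j + 1)) p ≡ -1ℤ → E (4 * p ^ (2 * α + 1) * n + ((8 * j + 1) * p ^ (2 * α) ∸ 1) / 2)
  part₂ j j<p leg = subst (λ a → E (4 * a * n + ((8 * j + 1) * P ∸ 1) / 2)) (sym Q≡)
    (even (P * p) ((8 * j + 1) * P) w numerator nonsquare)
    where
    w = j * P + proj₁ P≡
    numerator : (8 * j + 1) * P ≡ 8 * w + 1
    numerator = numerator₂ j P (proj₁ P≡) (proj₂ P≡)
    nonsquare : ∀ y → y * y ≢ 8 * (P * p * n + w) + 1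
    nonsquare y eq =
      let z , z²≡ = square-÷-^ p-prime α y (8 * n * p + (8 * j + 1)) (trans eq (factored₂ j p P n w numerator))
      in legendre≡-1⇒nonresidue (+ (8 * j + 1)) p leg (residue z (8 * j + 1) (8 * n) p z²≡)

theorem3p14 : ∀ (p : ℕ) (p-prime : Prime p) → 2 ∤ p → ∀ (α n : ℕ) →
    (∀ (i : ℕ) → 1 ≤ i → i < p →
    2 ∣ b 13 (4 * p ^ (2 * α + 2) * n + ((8 * i + p) * p ^ (2 * α + 1) ∸ 1) / 2))
    ×
    (∀ (j : ℕ) → j < p → legendre (+ (8 * j + 1)) p {{prime⇒nonZero p-prime}} ≡ -1ℤ →
    2 ∣ b 13 (4 * p ^ (2 * α + 1) * n + ((8 * j + 1) * p ^ (2 * α) ∸ 1) / 2))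
theorem3p14 p p-prime 2∤p α n = part₁ , part₂
  where open Progressions p-prime 2∤p α n (λ m → 2 ∣ b 13 m) b₁₃-even
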